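{- For every fixed integer $d\ge 2$, every online algorithm for vector packing (VP) in dimension $d$ has asymptotic competitive ratio at least $$\frac{\lfloor\sqrt{d-1}\rfloor+2}{2}.$$
   Context: Vector packing (VP) in dimension $d$: an item is a non-zero vector in $[0,1]^d$ with rational components. A packing of a finite collection of items is a partition of it into subsets called bins such that the vector sum of the items in every bin does not exceed $1$ in any component. For an input $L$ (a finite sequence of items), $OPT(L)$ is the minimum number of bins in a packing of the items of $L$. An online algorithm $A$ receives the items of $L$ one by one and packs each item irrevocably, before the next item is presented, into a new (empty) bin or into an already non-empty bin, keeping the packing feasible; its decisions are deterministic functions of the items presented so far (the total length of the input is not known to it). $A(L)$ denotes the number of bins $A$ uses for $L$. The asymptotic competitive ratio of $A$ is $$\lim_{K\to\infty}\ \sup_{L:\,OPT(L)\ge K}\ \frac{A(L)}{OPT(L)}\in[1,\infty].$$ The dimension $d$ is a fixed constant, known to the algorithm. -}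

module Defs where

open import Level using (0ℓ)
open import Data.Bool using (if_then_else_)
open import Data.Nat as ℕ using (ℕ; zero; suc; NonZero)
import Data.Nat.Properties as ℕ
open import Data.Integer using (+_)
open import Data.Rational as ℚ using (ℚ; 0ℚ; 1ℚ; _/_)
import Data.Rational.Properties as ℚ
open import Data.Fin using (Fin; zero; suc)
open import Data.List using (List; []; _∷_; length)
open import Data.Vec using (Vec; lookup; replicate)
open import Data.Product using (Σ; ∃; ∃-syntax; _×_; _,_)
open import Function using (_∘_)
open import Relation.Nullary using (does; yes; no)
open import Relation.Unary using (Pred)
open import Relation.Binary.PropositionalEquality using (_≡_; _≢_)

-- The proof fields are irrelevant and the coordinates form a Vec, so an item
-- is nothing more than its vector: an algorithm cannot look at anything else.
record Item (d : ℕ) : Set where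
  constructor item
  field
    coords   : Vec ℚ d
    .0≤coord : ∀ c → 0ℚ ℚ.≤ lookup coords c
    .coord≤1 : ∀ c → lookup coords c ℚ.≤ 1ℚ
    .nonzero : coords ≢ replicate d 0ℚ

open Item public using (coords)

-- A finite sequence of items, the most recent one first: x ∷ L is the input L
-- followed by the item x, and the prefixes of an input are its list tails.
Input : ℕ → Set
Input d = List (Item d)

-- A subdivision of the items of L into bins, by giving each item its bin.
Assignment : ∀ {d} → Input d → Set
Assignment L = Fin (length L) → ℕ

-- Component c of the vector sum of the items in bin k.
load : ∀ {d} (L : Input d) → Assignment L → ℕ → Fin d → ℚ
load []      b k c = 0ℚ
load (x ∷ L) b k c =
  (if does (b zero ℕ.≟ k) then lookup (coords x) c else 0ℚ) ℚ.+ load L (b ∘ suc) k c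

Feasible : ∀ {d} (L : Input d) → Assignment L → Set
Feasible L b = ∀ k c → load L b k c ℚ.≤ 1ℚ

-- A packing with exactly m bins, which are numbered 0, …, m - 1.
record IsPacking {d} (L : Input d) (m : ℕ) (b : Assignment L) : Set where
  field
    inRange  : ∀ i → b i ℕ.< m
    nonempty : ∀ k → k ℕ.< m → ∃[ i ] b i ≡ k
    feasible : Feasible L b

-- OPT(L) = m
record IsOPT {d} (L : Input d) (m : ℕ) : Set where
  field
    attained : ∃[ b ] IsPacking L m b
    minimal  : ∀ n b → IsPacking L n b → m ℕ.≤ n

-- σ L x is the bin chosen for the item x when it arrives after the input L.
Strategy : ℕ → Set
Strategy d = Input d → Item d → ℕ

-- If u bins are in use, they are numbered 0, …, u - 1, and choosing bin u
-- means opening a new one.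
used : ∀ {d} → Strategy d → Input d → ℕ
used σ []      = 0
used σ (x ∷ L) = if does (σ L x ℕ.≟ used σ L) then suc (used σ L) else used σ L

assigned : ∀ {d} → Strategy d → (L : Input d) → Assignment L
assigned σ (x ∷ L) zero    = σ L x
assigned σ (x ∷ L) (suc i) = assigned σ L i

record OnlineAlgorithm (d : ℕ) : Set where
  field
    strategy  : Strategy d
    usedOrNew : ∀ L x → strategy L x ℕ.≤ used strategy L
    feasible  : ∀ L → Feasible L (assigned strategy L)

-- A(L)
bins : ∀ {d} → OnlineAlgorithm d → Input d → ℕ
bins A = used (OnlineAlgorithm.strategy A)

-- Extended real numbers in [-∞,∞], as lower cuts: q ◁ x means q < x.
-- The empty cut is -∞ and the cut containing every rational is ∞.
record ExtReal : Set₁ where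
  field
    cut     : Pred ℚ 0ℓ
    down    : ∀ {p q} → p ℚ.< q → cut q → cut p
    rounded : ∀ {p} → cut p → ∃[ q ] p ℚ.< q × cut q

infix 4 _◁_ _≤ᴱ_

_◁_ : ℚ → ExtReal → Set
q ◁ x = ExtReal.cut x q

_≤ᴱ_ : ExtReal → ExtReal → Set
x ≤ᴱ y = ∀ q → q ◁ x → q ◁ y

fromℚ : ℚ → ExtReal
fromℚ r = record
  { cut     = ℚ._< r
  ; down    = ℚ.<-trans
  ; rounded = λ p<r → let m , p<m , m<r = ℚ.<-dense p<r in m , p<m , m<r
  }

sup : Pred ℚ 0ℓ → ExtReal
sup S = record
  { cut     = λ q → ∃[ s ] S s × q ℚ.< s
  ; down    = λ p<q (s , Ss , q<s) → s , Ss , ℚ.<-trans p<q q<s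
  ; rounded = λ (s , Ss , p<s) →
      let m , p<m , m<s = ℚ.<-dense p<s in m , p<m , s , Ss , m<s
  }

liminf : (ℕ → ExtReal) → ExtReal
liminf x = record
  { cut     = λ q → ∃[ p ] q ℚ.< p × ∃[ K₀ ] (∀ K → K₀ ℕ.≤ K → p ◁ x K)
  ; down    = λ q′<q (p , q<p , ev) → p , ℚ.<-trans q′<q q<p , ev
  ; rounded = λ (p , q<p , ev) →
      let m , q<m , m<p = ℚ.<-dense q<p in m , q<m , p , m<p , ev
  }

-- The values A(L)/OPT(L) over the inputs L with OPT(L) ≥ K (and OPT(L) ≠ 0, so
-- that the quotient makes sense; this is automatic for K ≥ 1).
ratiosFrom : ∀ {d} → OnlineAlgorithm d → ℕ → Pred ℚ 0ℓ
ratiosFrom A K r =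
  ∃[ L ] ∃[ m ] IsOPT L m × K ℕ.≤ m ×
    Σ (NonZero m) λ m≢0 → r ≡ (+ bins A L / m) {{m≢0}}

-- The suprema are nonincreasing in K (next lemma), so their limit exists and
-- is their limit inferior.
asymptoticRatio : ∀ {d} → OnlineAlgorithm d → ExtReal
asymptoticRatio A = liminf λ K → sup (ratiosFrom A K)

sup-ratiosFrom-antitone : ∀ {d} (A : OnlineAlgorithm d) {K K′} → K ℕ.≤ K′ →
  sup (ratiosFrom A K′) ≤ᴱ sup (ratiosFrom A K)
sup-ratiosFrom-antitone A K≤K′ q (s , (L , m , opt , K′≤m , rest) , q<s) =
  s , (L , m , opt , ℕ.≤-trans K≤K′ K′≤m , rest) , q<s

⌊√_⌋ : ℕ → ℕ
⌊√ zero ⌋  = 0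
⌊√ suc n ⌋ with suc ⌊√ n ⌋ ℕ.* suc ⌊√ n ⌋ ℕ.≤? suc n
... | yes _ = suc ⌊√ n ⌋
... | no  _ = ⌊√ n ⌋

⌊√⌋-spec : ∀ n → ⌊√ n ⌋ ℕ.* ⌊√ n ⌋ ℕ.≤ n × n ℕ.< suc ⌊√ n ⌋ ℕ.* suc ⌊√ n ⌋
⌊√⌋-spec zero = ℕ.z≤n , ℕ.s≤s ℕ.z≤n
⌊√⌋-spec (suc n) with suc ⌊√ n ⌋ ℕ.* suc ⌊√ n ⌋ ℕ.≤? suc n | ⌊√⌋-spec n
... | yes p | _ , n<s² =
  p , ℕ.≤-trans (ℕ.s≤s n<s²) (ℕ.*-mono-< (ℕ.n<1+n (suc ⌊√ n ⌋)) (ℕ.n<1+n (suc ⌊√ n ⌋)))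
... | no ¬p | s²≤n , _ = ℕ.m≤n⇒m≤1+n s²≤n , ℕ.≰⇒> ¬p

-- The adversary first presents many tiny items, which are equal in the cardinality
-- component. The first one in each bin of the algorithm turns out to be large and the
-- others small: sizes are chosen adaptively so that in the other relevant components
-- all small items together are smaller than any large one. Offline, the few large items
-- fit into a negligible number of bins and the small ones into M bins (the slots),
-- while every bin of the algorithm is blocked for all later items.
--
-- Then there are r phases of nearly M big items each, one per slot. Big items of the
-- same phase exclude each other. Those of each phase are linearly ordered by a position,
-- in accordance with their slots, and a later item can be made compatible with an
-- arbitrary interval of positions for each earlier phase. In each phase the classes of
-- slots are bisected repeatedly: a new item is compatible with all items of the class,
-- and once the algorithm has packed it, it gets a slot in the half that does not
-- contain the slot of the item it was packed with. Its position is between those of the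
-- two halves, so it can still go either way. As later items are compatible with only
-- one of the halves, no bin of the algorithm ever has more than two big items. So the
-- algorithm uses at least about M + r M / 2 bins instead of M.
module Submission where

open import Defs
open import Data.Bool using (if_then_else_)
open import Data.Fin using (Fin; zero; suc; toℕ; fromℕ<; combine; remQuot)
open import Data.Fin.Properties using (all?; any?; toℕ<n; toℕ-fromℕ<; toℕ-injective; remQuot-combine)
open import Data.List using (List; []; _∷_; length; map)
open import Data.List.Membership.Propositional using (_∈_)
open import Data.List.Relation.Unary.All as All using (All; []; _∷_)
open import Data.List.Relation.Unary.Any using (here; there)
open import Data.Maybe using (Maybe; just; nothing)
open import Data.Nat
  using (ℕ; zero; suc; _≤_; _<_; _+_; _*_; _^_; _∸_; _≟_; _≤?_; _<?_; z≤n; s≤s; s≤s⁻¹; >-nonZero)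
open import Data.Nat.Divisibility using (_∣_; divides; ∣m∣n⇒∣m+n; n∣m*n; *-monoʳ-∣; ∣-trans)
import Data.Nat.Properties as ℕ
open import Data.Nat.Tactic.RingSolver using (solve-∀)
open import Data.Product using (∃; ∃-syntax; Σ-syntax; _×_; _,_; proj₁; proj₂; uncurry)
open import Data.Rational as ℚ using (ℚ; 0ℚ; 1ℚ; ½; _/_; ↥_; ↧_; ↧ₙ_; toℚᵘ)
import Data.Rational.Properties as ℚ
open import Data.Sum as Sum using (_⊎_; inj₁; inj₂; [_,_]′)
open import Data.Vec using (Vec; []; _∷_; lookup; tabulate)
open import Data.Vec.Properties using (lookup∘tabulate; lookup-replicate)
open import Function using (_∘_; id)
open import Relation.Binary.Bundles using (DecTotalOrder)
open import Relation.Binary.Definitions using (tri<; tri≈; tri>)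
open import Relation.Binary.PropositionalEquality
open import Relation.Nullary using (¬_; Dec; yes; no; contradiction)
open import Relation.Nullary.Decidable using (map′; dec-true; dec-false)
open import Relation.Unary using (Decidable)
open import Algebra.Properties.CommutativeSemigroup ℕ.+-commutativeSemigroup using (interchange)
open import Algebra.Properties.CommutativeSemigroup ℕ.*-commutativeSemigroup using (x∙yz≈y∙xz)
open import Data.List.Extrema (DecTotalOrder.totalOrder ℚ.≤-decTotalOrder)
  using (max; min; ⊥≤max; xs≤max; max<v⁺; min≤⊤; min≤xs; v<min⁺)

-- Optimal packings

load-hit : ∀ {d} (x : Item d) L (b : Assignment (x ∷ L)) {k} c → b zero ≡ k →
  load (x ∷ L) b k c ≡ lookup (coords x) c ℚ.+ load L (b ∘ suc) k c
load-hit x L b {k} c eq =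
  cong (λ t → (if t then lookup (coords x) c else 0ℚ) ℚ.+ load L (b ∘ suc) k c)
       (dec-true (b zero ≟ k) eq)

load-miss : ∀ {d} (x : Item d) L (b : Assignment (x ∷ L)) {k} c → b zero ≢ k →
  load (x ∷ L) b k c ≡ load L (b ∘ suc) k c
load-miss x L b {k} c neq = trans
  (cong (λ t → (if t then lookup (coords x) c else 0ℚ) ℚ.+ load L (b ∘ suc) k c)
        (dec-false (b zero ≟ k) neq))
  (ℚ.+-identityˡ _)

load-cong : ∀ {d} (L : Input d) {b b′ : Assignment L} {k k′} c →
  (∀ i → b i ≡ k → b′ i ≡ k′) → (∀ i → b′ i ≡ k′ → b i ≡ k) →
  load L b k c ≡ load L b′ k′ c
load-cong []      c to from = refl
load-cong (x ∷ L) {b} {b′} {k} {k′} c to from with b zero ≟ k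
... | yes p = trans (load-hit x L b c p)
  (trans (cong (lookup (coords x) c ℚ.+_) (load-cong L c (to ∘ suc) (from ∘ suc)))
         (sym (load-hit x L b′ c (to zero p))))
... | no ¬p = trans (load-miss x L b c ¬p)
  (trans (load-cong L c (to ∘ suc) (from ∘ suc))
         (sym (load-miss x L b′ c (¬p ∘ from zero))))

load-unused : ∀ {d} (L : Input d) {b : Assignment L} {k} c → (∀ i → b i ≢ k) →
  load L b k c ≡ 0ℚ
load-unused []      c unused = refl
load-unused (x ∷ L) {b} c unused =
  trans (load-miss x L b c (unused zero)) (load-unused L c (unused ∘ suc))

load-unused≤1 : ∀ {d} (L : Input d) {b : Assignment L} {k} c → (∀ i → b i ≢ k) →
  load L b k c ℚ.≤ 1ℚ
load-unused≤1 L {b} {k} c unused =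
  subst (ℚ._≤ 1ℚ) (sym (load-unused L {b} {k} c unused)) (ℚ.nonNegative⁻¹ 1ℚ)

-- Unlike in `IsPacking`, bins may stay empty. So a feasible assignment such as that to the slots
-- qualifies at once, and an optimal packing is found by minimising `m`.
record Fits {d} (L : Input d) (m : ℕ) : Set where
  constructor fits
  field
    assignment : Assignment L
    inRange    : ∀ i → assignment i < m
    feasible   : Feasible L assignment

anyVec? : ∀ {m} n {P : Vec (Fin m) n → Set} → Decidable P → Dec (∃ P)
anyVec? zero    P? = map′ ([] ,_) (λ { ([] , p) → p }) (P? [])
anyVec? (suc n) P? =
  map′ (λ (x , v , p) → (x ∷ v) , p) (λ { ((x ∷ v) , p) → x , v , p })
       (any? λ x → anyVec? n λ v → P? (x ∷ v))

-- Makes the search for the least number of bins constructive: assignments into `m` bins are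
-- finitely many vectors over `Fin m`, and bins numbered `m` or more have load 0.
fits? : ∀ {d} (L : Input d) m → Dec (Fits L m)
fits? {d} L m =
  map′ to from (anyVec? (length L) λ v → all? λ k → all? λ c → load L (bin v) (toℕ k) c ℚ.≤? 1ℚ)
  where
  bin : Vec (Fin m) (length L) → Assignment L
  bin v i = toℕ (lookup v i)

  Fine : Vec (Fin m) (length L) → Set
  Fine v = ∀ (k : Fin m) c → load L (bin v) (toℕ k) c ℚ.≤ 1ℚ

  to : ∃ Fine → Fits L m
  to (v , fine) = fits (bin v) (λ i → toℕ<n (lookup v i)) feasible
    where
    feasible : Feasible L (bin v)
    feasible k c with k <? m
    ... | yes k<m = subst (λ k → load L (bin v) k c ℚ.≤ 1ℚ) (toℕ-fromℕ< k<m) (fine (fromℕ< k<m) c)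
    ... | no k≮m  = load-unused≤1 L c λ i eq → k≮m (subst (_< m) eq (toℕ<n (lookup v i)))

  from : Fits L m → ∃ Fine
  from (fits b b<m feasible) = v , λ k c →
    subst (ℚ._≤ 1ℚ) (load-cong L c (λ i → trans (eq i)) (λ i → trans (sym (eq i)))) (feasible (toℕ k) c)
    where
    v = tabulate λ i → fromℕ< (b<m i)

    eq : ∀ i → bin v i ≡ b i
    eq i = trans (cong toℕ (lookup∘tabulate (λ i → fromℕ< (b<m i)) i)) (toℕ-fromℕ< (b<m i))

-- The last bin takes the number of the unused one.
drop-unused : ∀ {d} (L : Input d) {m k} → k < suc m → (F : Fits L (suc m)) →
  (∀ i → Fits.assignment F i ≢ k) → Fits L m
drop-unused L {m} {k} k≤m (fits b b<1+m feasible) unused = fits b′ b′<m feasible′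
  where
  b′ : Assignment L
  b′ i with b i ≟ m
  ... | yes _ = k
  ... | no _  = b i

  b′<m : ∀ i → b′ i < m
  b′<m i with b i ≟ m
  ... | yes p = ℕ.≤∧≢⇒< (s≤s⁻¹ k≤m) λ k≡m → unused i (trans p (sym k≡m))
  ... | no ¬p = ℕ.≤∧≢⇒< (s≤s⁻¹ (b<1+m i)) ¬p

  feasible′ : Feasible L b′
  feasible′ j c with j ≟ k
  ... | yes refl = subst (ℚ._≤ 1ℚ) (load-cong L c to from) (feasible m c)
    where
    to : ∀ i → b i ≡ m → b′ i ≡ k
    to i eq with b i ≟ m
    ... | yes _ = refl
    ... | no ¬p = contradiction eq ¬p

    from : ∀ i → b′ i ≡ k → b i ≡ m
    from i eq with b i ≟ m
    ... | yes p = p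
    ... | no _  = contradiction eq (unused i)
  ... | no j≢k with j <? m
  ...   | no j≮m  = load-unused≤1 L c λ i eq → j≮m (subst (_< m) eq (b′<m i))
  ...   | yes j<m = subst (ℚ._≤ 1ℚ) (load-cong L c to from) (feasible j c)
    where
    to : ∀ i → b i ≡ j → b′ i ≡ j
    to i eq with b i ≟ m
    ... | yes p = contradiction (trans (sym eq) p) (ℕ.<⇒≢ j<m)
    ... | no _  = eq

    from : ∀ i → b′ i ≡ j → b i ≡ j
    from i eq with b i ≟ m
    ... | yes _ = contradiction (sym eq) j≢k
    ... | no _  = eq

least : ∀ {P : ℕ → Set} → Decidable P → ∀ n → P n → ∃[ m ] P m × m ≤ n × (∀ i → P i → m ≤ i)
least {P} P? n pn with P? 0
... | yes p0 = 0 , p0 , z≤n , λ _ _ → z≤n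
least {P} P? zero    pn | no ¬p0 = contradiction pn ¬p0
least {P} P? (suc n) pn | no ¬p0 =
  let m , pm , m≤n , min = least (P? ∘ suc) n pn in
  suc m , pm , s≤s m≤n , λ { zero p → contradiction p ¬p0 ; (suc i) p → s≤s (min i p) }

fits⇒OPT : ∀ {d} (L : Input d) {n} → Fits L n → ∃[ m ] IsOPT L m × Fits L m × m ≤ n
fits⇒OPT L {n} F with least (fits? L) n F
... | m , G@(fits b b<m feasible) , m≤n , minimal = m , record
  { attained = b , record
    { inRange  = b<m
    ; nonempty = nonempty
    ; feasible = feasible
    }
  ; minimal  = λ i b′ P → minimal i (fits b′ (IsPacking.inRange P) (IsPacking.feasible P))
  } , G , m≤n
  where
  smaller : ∀ {m} k → k < m → (G : Fits L m) → (∀ i → Fits L i → m ≤ i) →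
    ∃[ i ] Fits.assignment G i ≡ k
  smaller {suc m} k k<m G min with any? (λ i → Fits.assignment G i ≟ k)
  ... | yes p = p
  ... | no ¬p = contradiction (min m (drop-unused L k<m G λ i eq → ¬p (i , eq))) (ℕ.<-irrefl refl)

  nonempty : ∀ k → k < m → ∃[ i ] b i ≡ k
  nonempty k k<m = smaller k k<m G minimal

-- Items

-- Strict bounds keep the type closed under `∁`; the value 0 is represented by an absent component
-- instead.
record 𝕀 : Set where
  constructor ⟨_,_,_⟩
  field
    val   : ℚ
    0<val : 0ℚ ℚ.< val
    val<1 : val ℚ.< 1ℚ

open 𝕀 public

0<q-p : ∀ {p q} → p ℚ.< q → 0ℚ ℚ.< q ℚ.- p
0<q-p {p} {q} p<q = subst (ℚ._< q ℚ.- p) (ℚ.+-inverseʳ p) (ℚ.+-monoˡ-< (ℚ.- p) p<q)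

∁ : 𝕀 → 𝕀
∁ ⟨ p , 0<p , p<1 ⟩ = ⟨ 1ℚ ℚ.- p , 0<q-p p<1 , ℚ.+-monoʳ-< 1ℚ (ℚ.neg-antimono-< 0<p) ⟩

value : Maybe 𝕀 → ℚ
value (just p) = val p
value nothing  = 0ℚ

0≤value : ∀ m → 0ℚ ℚ.≤ value m
0≤value (just p) = ℚ.<⇒≤ (0<val p)
0≤value nothing  = ℚ.≤-refl

value≤1 : ∀ m → value m ℚ.≤ 1ℚ
value≤1 (just p) = ℚ.<⇒≤ (val<1 p)
value≤1 nothing  = ℚ.nonNegative⁻¹ 1ℚ

-- The components of the vectors: one for the cardinalities, one per phase, and
-- two for each pair of phases s < u; the superfluous ones are idle.
data Side : Set where
  left right : Side

data Dim : Set where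
  card : Dim
  diag : ℕ → Dim
  pair : Side → (s u : ℕ) → Dim
  idle : Dim

data Valid (r : ℕ) : Dim → Set where
  card : Valid r card
  diag : ∀ {t} → t < r → Valid r (diag t)
  pair : ∀ {σ s u} → s < u → u < r → Valid r (pair σ s u)

-- The phase components form the diagonal of an `r` by `r` matrix, those of the pairs its two
-- triangles, one per side. With the cardinality this makes `r * r + 1` dimensions, whence the root
-- of `d - 1` in the theorem.
cell : ℕ → ℕ → Dim
cell x y with ℕ.<-cmp x y
... | tri< _ _ _ = pair left x y
... | tri≈ _ _ _ = diag x
... | tri> _ _ _ = pair right y x

cell-valid : ∀ {r x y} → x < r → y < r → Valid r (cell x y)
cell-valid {r} {x} {y} x<r y<r with ℕ.<-cmp x y
... | tri< x<y _ _ = pair x<y y<r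
... | tri≈ _ _ _   = diag x<r
... | tri> _ _ y<x = pair y<x x<r

decode : ∀ r {d} → Fin d → Dim
decode r zero = card
decode r (suc i) with toℕ i <? r * r
... | yes i<r² = uncurry (λ x y → cell (toℕ x) (toℕ y)) (remQuot {r} r (fromℕ< i<r²))
... | no _     = idle

decode-valid : ∀ r {d} (c : Fin d) → decode r c ≡ idle ⊎ Valid r (decode r c)
decode-valid r zero = inj₂ card
decode-valid r (suc i) with toℕ i <? r * r
... | yes i<r² = let x , y = remQuot {r} r (fromℕ< i<r²) in inj₂ (cell-valid (toℕ<n x) (toℕ<n y))
... | no _     = inj₁ refl

decode-cell : ∀ {r d x y} → r * r ≤ d → x < r → y < r → ∃[ c ] decode r {suc d} c ≡ cell x y
decode-cell {r} {d} {x} {y} r²≤d x<r y<r = suc i , eq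
  where
  j = combine (fromℕ< x<r) (fromℕ< y<r)
  i = fromℕ< (ℕ.<-≤-trans (toℕ<n j) r²≤d)

  eq : decode r (suc i) ≡ cell x y
  eq with toℕ i <? r * r
  ... | no i≮  = contradiction (subst (_< r * r) (sym (toℕ-fromℕ< _)) (toℕ<n j)) i≮
  ... | yes i< = begin
    uncurry f (remQuot {r} r (fromℕ< i<)) ≡⟨ cong (uncurry f ∘ remQuot {r} r) i≡j ⟩
    uncurry f (remQuot {r} r j)           ≡⟨ cong (uncurry f) (remQuot-combine (fromℕ< x<r) (fromℕ< y<r)) ⟩
    f (fromℕ< x<r) (fromℕ< y<r)           ≡⟨ cong₂ cell (toℕ-fromℕ< x<r) (toℕ-fromℕ< y<r) ⟩
    cell x y                              ∎
    where
    open ≡-Reasoning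
    f : Fin r → Fin r → Dim
    f x y = cell (toℕ x) (toℕ y)

    i≡j : fromℕ< i< ≡ j
    i≡j = toℕ-injective (trans (toℕ-fromℕ< i<) (toℕ-fromℕ< _))

decode-surjective : ∀ {r d δ} → r * r ≤ d → Valid r δ → ∃[ c ] decode r {suc d} c ≡ δ
decode-surjective r²≤d card = zero , refl
decode-surjective r²≤d (diag {t} t<r) with decode-cell r²≤d t<r t<r
... | c , eq with ℕ.<-cmp t t
...   | tri< t<t _ _ = contradiction t<t (ℕ.<-irrefl refl)
...   | tri≈ _ _ _   = c , eq
...   | tri> _ _ t<t = contradiction t<t (ℕ.<-irrefl refl)
decode-surjective r²≤d (pair {left} {s} {u} s<u u<r) with decode-cell r²≤d (ℕ.<-trans s<u u<r) u<r
... | c , eq with ℕ.<-cmp s u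
...   | tri< _ _ _   = c , eq
...   | tri≈ _ s≡u _ = contradiction s<u (ℕ.<-irrefl s≡u)
...   | tri> s≮u _ _ = contradiction s<u s≮u
decode-surjective r²≤d (pair {right} {s} {u} s<u u<r) with decode-cell r²≤d u<r (ℕ.<-trans s<u u<r)
... | c , eq with ℕ.<-cmp u s
...   | tri< _ _ s≮u = contradiction s<u s≮u
...   | tri≈ _ _ s≮u = contradiction s<u s≮u
...   | tri> _ _ _   = c , eq

-- A big item at position p has p and 1 - p in the two components reserved for
-- its phase s and a later phase u. A big item of phase u can share a bin with it
-- only if these numbers are at most limit left s and limit right s.
record BigShape (r : ℕ) : Set where
  field
    phase  : ℕ
    phase< : phase < r
    α      : 𝕀
    ½<α    : ½ ℚ.< val α
    pos    : 𝕀
    limit  : Side → ℕ → 𝕀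

  distance : Side → 𝕀
  distance left  = pos
  distance right = ∁ pos

open BigShape public

data Shape (r : ℕ) : Set where
  tiny : 𝕀 → Shape r
  big  : BigShape r → Shape r

-- κ is the share of a tiny item in the cardinality component.
module Vectors (r d : ℕ) (r²≤d : r * r ≤ d) (κ : 𝕀) where

  -- Tiny items show their size in every phase component, so that a large one blocks its bin for all
  -- phases. In a component shared with an earlier phase, a big item takes the complement of its
  -- limit and thus leaves exactly the limit free.
  coord : Shape r → Dim → Maybe 𝕀
  coord (tiny v) card     = just κ
  coord (tiny v) (diag _) = just v
  coord (tiny v) _        = nothing
  coord (big b) (diag s) with s ≟ phase b
  ... | yes _ = just (α b)
  ... | no _  = nothing
  coord (big b) (pair σ s u) with s ≟ phase b | u ≟ phase b
  ... | yes _ | _     = just (distance b σ)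
  ... | no _  | yes _ = just (∁ (limit b σ s))
  ... | no _  | no _  = nothing
  coord (big b) _ = nothing

  diag-own : ∀ b → coord (big b) (diag (phase b)) ≡ just (α b)
  diag-own b with phase b ≟ phase b
  ... | yes _ = refl
  ... | no ¬p = contradiction refl ¬p

  diag-other : ∀ b {s} → s ≢ phase b → coord (big b) (diag s) ≡ nothing
  diag-other b {s} neq with s ≟ phase b
  ... | yes p = contradiction p neq
  ... | no _  = refl

  pair-own : ∀ b σ {s} u → s ≡ phase b → coord (big b) (pair σ s u) ≡ just (distance b σ)
  pair-own b σ {s} u eq with s ≟ phase b | u ≟ phase b
  ... | yes _ | _ = refl
  ... | no ¬p | _ = contradiction eq ¬p

  pair-later : ∀ b σ {s u} → s ≢ phase b → u ≡ phase b →
    coord (big b) (pair σ s u) ≡ just (∁ (limit b σ s))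
  pair-later b σ {s} {u} neq eq with s ≟ phase b | u ≟ phase b
  ... | yes p | _     = contradiction p neq
  ... | no _  | yes _ = refl
  ... | no _  | no ¬p = contradiction eq ¬p

  pair-other : ∀ b σ {s u} → s ≢ phase b → u ≢ phase b →
    coord (big b) (pair σ s u) ≡ nothing
  pair-other b σ {s} {u} s≢ u≢ with s ≟ phase b | u ≟ phase b
  ... | yes p | _     = contradiction p s≢
  ... | no _  | yes p = contradiction p u≢
  ... | no _  | no _  = refl

  component : Shape r → Fin (suc d) → ℚ
  component s c = value (coord s (decode r c))

  component>0 : ∀ s → ∃[ c ] 0ℚ ℚ.< component s c
  component>0 (tiny v) = zero , 0<val κ
  component>0 (big b) with decode-surjective r²≤d (diag (phase< b))
  ... | c , eq = c , subst (0ℚ ℚ.<_) (sym α≡) (0<val (α b))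
    where
    α≡ : component (big b) c ≡ val (α b)
    α≡ = trans (cong (value ∘ coord (big b)) eq) (cong value (diag-own b))

  toItem : Shape r → Item (suc d)
  toItem s = item (tabulate (component s))
    (λ c → subst (0ℚ ℚ.≤_) (sym (component≡ c)) (0≤value (coord s (decode r c))))
    (λ c → subst (ℚ._≤ 1ℚ) (sym (component≡ c)) (value≤1 (coord s (decode r c))))
    λ zeros → let c , 0<sc = component>0 s in
      ℚ.<⇒≢ 0<sc (sym (trans (sym (component≡ c))
        (trans (cong (λ v → lookup v c) zeros) (lookup-replicate c 0ℚ))))
    where
    component≡ : ∀ c → lookup (tabulate (component s)) c ≡ component s c
    component≡ = lookup∘tabulate (component s)

  -- An item together with the bin chosen by the algorithm and with its slot,
  -- the bin of the offline packing to which the adversary assigns it.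
  data Entry : Set where
    small large : (v : 𝕀) (slot bin : ℕ) → Entry
    big         : (b : BigShape r) (slot bin : ℕ) → Entry

  shape : Entry → Shape r
  shape (small v _ _) = tiny v
  shape (large v _ _) = tiny v
  shape (big b _ _)   = big b

  slot bin : Entry → ℕ
  slot (small _ i _) = i
  slot (large _ i _) = i
  slot (big _ i _)   = i
  bin (small _ _ k) = k
  bin (large _ _ k) = k
  bin (big _ _ k)   = k

  input : List Entry → Input (suc d)
  input = map (toItem ∘ shape)

  -- The assignment is a parameter, so that one notion covers the bins of the algorithm, the slots
  -- and an arbitrary packing.
  contentOf : (E : List Entry) → Assignment (input E) → ℕ → List Entry
  contentOf []      b k = []
  contentOf (e ∷ E) b k with b zero ≟ k
  ... | yes _ = e ∷ contentOf E (b ∘ suc) k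
  ... | no _  = contentOf E (b ∘ suc) k

  label : (Entry → ℕ) → (E : List Entry) → Assignment (input E)
  label f (e ∷ E) zero    = f e
  label f (e ∷ E) (suc i) = label f E i

  content : (Entry → ℕ) → List Entry → ℕ → List Entry
  content f E = contentOf E (label f E)

  content-hit : ∀ f e E {k} → f e ≡ k → content f (e ∷ E) k ≡ e ∷ content f E k
  content-hit f e E {k} eq with f e ≟ k
  ... | yes _ = refl
  ... | no ¬p = contradiction eq ¬p

  content-miss : ∀ f e E {k} → f e ≢ k → content f (e ∷ E) k ≡ content f E k
  content-miss f e E {k} neq with f e ≟ k
  ... | yes p = contradiction p neq
  ... | no _  = refl

  content-elim : ∀ (Q : List Entry → Set) f e E {k} →
    (f e ≡ k → Q (e ∷ content f E k)) → (f e ≢ k → Q (content f E k)) → Q (content f (e ∷ E) k)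
  content-elim Q f e E {k} hit miss with f e ≟ k
  ... | yes p = hit p
  ... | no ¬p = miss ¬p

  content-⊆ : ∀ f E {k x} → x ∈ content f E k → x ∈ E × f x ≡ k
  content-⊆ f (e ∷ E) {k} x∈ with f e ≟ k | x∈
  ... | yes p | here refl = here refl , p
  ... | yes _ | there x∈′ = let p , q = content-⊆ f E x∈′ in there p , q
  ... | no _  | x∈′       = let p , q = content-⊆ f E x∈′ in there p , q

  total : Dim → List Entry → ℚ
  total δ []      = 0ℚ
  total δ (e ∷ E) = value (coord (shape e) δ) ℚ.+ total δ E

  0≤total : ∀ δ E → 0ℚ ℚ.≤ total δ E
  0≤total δ []      = ℚ.≤-refl
  0≤total δ (e ∷ E) = ℚ.+-mono-≤ (0≤value (coord (shape e) δ)) (0≤total δ E)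

  load≡total : ∀ E b k c → load (input E) b k c ≡ total (decode r c) (contentOf E b k)
  load≡total []      b k c = refl
  load≡total (e ∷ E) b k c with b zero ≟ k
  ... | yes p = trans (load-hit (toItem (shape e)) (input E) b c p)
    (cong₂ ℚ._+_ (lookup∘tabulate (component (shape e)) c) (load≡total E (b ∘ suc) k c))
  ... | no ¬p = trans (load-miss (toItem (shape e)) (input E) b c ¬p)
    (load≡total E (b ∘ suc) k c)

  idle≡0 : ∀ E → total idle E ≡ 0ℚ
  idle≡0 []                = refl
  idle≡0 (small _ _ _ ∷ E) = trans (ℚ.+-identityˡ _) (idle≡0 E)
  idle≡0 (large _ _ _ ∷ E) = trans (ℚ.+-identityˡ _) (idle≡0 E)
  idle≡0 (big _ _ _ ∷ E)   = trans (ℚ.+-identityˡ _) (idle≡0 E)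

  -- Every valid component is realised by some coordinate because `r * r ≤ d`. For the converse, the
  -- remaining coordinates are idle and have total 0.
  feasible⇒total≤1 : ∀ E b → Feasible (input E) b →
    ∀ k {δ} → Valid r δ → total δ (contentOf E b k) ℚ.≤ 1ℚ
  feasible⇒total≤1 E b feasible k v with decode-surjective r²≤d v
  ... | c , eq = subst (λ δ → total δ (contentOf E b k) ℚ.≤ 1ℚ) eq
    (subst (ℚ._≤ 1ℚ) (load≡total E b k c) (feasible k c))

  total≤1⇒feasible : ∀ E b → (∀ k {δ} → Valid r δ → total δ (contentOf E b k) ℚ.≤ 1ℚ) →
    Feasible (input E) b
  total≤1⇒feasible E b bound k c with decode-valid r c
  ... | inj₂ v  = subst (ℚ._≤ 1ℚ) (sym (load≡total E b k c)) (bound k v)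
  ... | inj₁ eq = subst (ℚ._≤ 1ℚ)
    (sym (trans (load≡total E b k c)
      (trans (cong (λ δ → total δ (contentOf E b k)) eq) (idle≡0 (contentOf E b k)))))
    (ℚ.nonNegative⁻¹ 1ℚ)

  -- Counting entries bin by bin

  sum : (Entry → ℕ) → List Entry → ℕ
  sum w []      = 0
  sum w (e ∷ E) = w e + sum w E

  tinies larges bigs : Entry → ℕ
  tinies (big _ _ _)   = 0
  tinies _             = 1
  larges (large _ _ _) = 1
  larges _             = 0
  bigs (big _ _ _)     = 1
  bigs _               = 0

  sumBelow : (ℕ → ℕ) → ℕ → ℕ
  sumBelow g zero    = 0
  sumBelow g (suc n) = g n + sumBelow g n

  sumBelow-cong : ∀ {g h} n → (∀ k → k < n → g k ≡ h k) → sumBelow g n ≡ sumBelow h n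
  sumBelow-cong zero    eq = refl
  sumBelow-cong (suc n) eq =
    cong₂ _+_ (eq n ℕ.≤-refl) (sumBelow-cong n λ k k<n → eq k (ℕ.m≤n⇒m≤1+n k<n))

  sumBelow-mono : ∀ {g h} n → (∀ k → g k ≤ h k) → sumBelow g n ≤ sumBelow h n
  sumBelow-mono zero    le = z≤n
  sumBelow-mono (suc n) le = ℕ.+-mono-≤ (le n) (sumBelow-mono n le)

  sumBelow-const : ∀ c n → sumBelow (λ _ → c) n ≡ n * c
  sumBelow-const c zero    = refl
  sumBelow-const c (suc n) = cong (c +_) (sumBelow-const c n)

  sumBelow-bump : ∀ {g h} w {j} n → j < n → g j ≡ w + h j → (∀ k → j ≢ k → g k ≡ h k) →
    sumBelow g n ≡ w + sumBelow h n
  sumBelow-bump {g} {h} w {j} (suc n) j<1+n at off with j ≟ n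
  ... | yes refl = trans
    (cong₂ _+_ at (sumBelow-cong n λ k k<n → off k (ℕ.>⇒≢ k<n)))
    (ℕ.+-assoc w (h n) (sumBelow h n))
  ... | no j≢n = begin
    g n + sumBelow g n       ≡⟨ cong₂ _+_ (off n j≢n) (sumBelow-bump w n j<n at off) ⟩
    h n + (w + sumBelow h n) ≡⟨ ℕ.+-assoc (h n) w _ ⟨
    (h n + w) + sumBelow h n ≡⟨ cong (_+ sumBelow h n) (ℕ.+-comm (h n) w) ⟩
    (w + h n) + sumBelow h n ≡⟨ ℕ.+-assoc w (h n) _ ⟩
    w + (h n + sumBelow h n) ∎
    where
    open ≡-Reasoning
    j<n = ℕ.≤∧≢⇒< (s≤s⁻¹ j<1+n) j≢n

  -- Double counting: each entry lies in exactly one bin below `n`, so a further entry changes the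
  -- term of that bin only.
  sum-contents : ∀ w E b n → (∀ i → b i < n) →
    sum w E ≡ sumBelow (λ k → sum w (contentOf E b k)) n
  sum-contents w []      b n b<n = sym (trans (sumBelow-const 0 n) (ℕ.*-zeroʳ n))
  sum-contents w (e ∷ E) b n b<n = sym (trans
    (sumBelow-bump {g} (w e) n (b<n zero) hit miss)
    (cong (w e +_) (sym (sum-contents w E (b ∘ suc) n (b<n ∘ suc)))))
    where
    g h : ℕ → ℕ
    g k = sum w (contentOf (e ∷ E) b k)
    h k = sum w (contentOf E (b ∘ suc) k)

    hit : g (b zero) ≡ w e + h (b zero)
    hit with b zero ≟ b zero
    ... | yes _ = refl
    ... | no ¬p = contradiction refl ¬p

    miss : ∀ k → b zero ≢ k → g k ≡ h k
    miss k neq with b zero ≟ k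
    ... | yes p = contradiction p neq
    ... | no _  = refl

  sum-≤-* : ∀ w {B} E b n → (∀ i → b i < n) → (∀ k → sum w (contentOf E b k) ≤ B) →
    sum w E ≤ n * B
  sum-≤-* w {B} E b n b<n le = subst₂ _≤_ (sym (sum-contents w E b n b<n)) (sumBelow-const B n)
    (sumBelow-mono n le)

  sum-mono : ∀ w w′ E b n → (∀ i → b i < n) →
    (∀ k → sum w (contentOf E b k) ≤ sum w′ (contentOf E b k)) → sum w E ≤ sum w′ E
  sum-mono w w′ E b n b<n le = subst₂ _≤_
    (sym (sum-contents w E b n b<n)) (sym (sum-contents w′ E b n b<n)) (sumBelow-mono n le)

  sum-* : ∀ c w E → sum (λ e → c * w e) E ≡ c * sum w E
  sum-* c w []      = sym (ℕ.*-zeroʳ c)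
  sum-* c w (e ∷ E) = trans (cong (c * w e +_) (sum-* c w E)) (sym (ℕ.*-distribˡ-+ c (w e) _))

  sum-+ : ∀ w w′ E → sum (λ e → w e + w′ e) E ≡ sum w E + sum w′ E
  sum-+ w w′ []      = refl
  sum-+ w w′ (e ∷ E) = trans (cong (w e + w′ e +_) (sum-+ w w′ E))
    (interchange (w e) (w′ e) (sum w E) (sum w′ E))

  multiple : ℕ → ℚ
  multiple zero    = 0ℚ
  multiple (suc n) = val κ ℚ.+ multiple n

  total-card : ∀ E → total card E ≡ multiple (sum tinies E)
  total-card []                = refl
  total-card (small _ _ _ ∷ E) = cong (val κ ℚ.+_) (total-card E)
  total-card (large _ _ _ ∷ E) = cong (val κ ℚ.+_) (total-card E)
  total-card (big _ _ _ ∷ E)   = trans (ℚ.+-identityˡ _) (total-card E)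

  multiple-mono : ∀ {m n} → m ≤ n → multiple m ℚ.≤ multiple n
  multiple-mono {n = zero}  z≤n       = ℚ.≤-refl
  multiple-mono {n = suc n} z≤n       =
    ℚ.+-mono-≤ (ℚ.<⇒≤ (0<val κ)) (multiple-mono {n = n} z≤n)
  multiple-mono             (s≤s m≤n) = ℚ.+-monoʳ-≤ (val κ) (multiple-mono m≤n)

  multiple<suc : ∀ n → multiple n ℚ.< multiple (suc n)
  multiple<suc n = subst (ℚ._< multiple (suc n)) (ℚ.+-identityˡ _)
    (ℚ.+-monoˡ-< (multiple n) (0<val κ))

  -- Once `multiple K` is known to be 1, this turns the capacity of the cardinality component into a
  -- bound of `K` tiny items per bin.
  multiple-cancel : ∀ {m n} → multiple m ℚ.≤ multiple n → m ≤ n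
  multiple-cancel {m} {n} le = ℕ.≮⇒≥ λ n<m →
    ℚ.<-irrefl refl (ℚ.<-≤-trans (multiple<suc n) (ℚ.≤-trans (multiple-mono n<m) le))

-- The game

-- Density of the rationals between a maximum and a minimum. Including 0 and 1 among the bounds
-- covers empty lists and puts the separator into `𝕀`.
separate : ∀ {xs ys} → All (0ℚ ℚ.<_) ys → All (ℚ._< 1ℚ) xs → All (λ x → All (x ℚ.<_) ys) xs →
  Σ[ q ∈ 𝕀 ] All (ℚ._< val q) xs × All (val q ℚ.<_) ys
separate {xs} {ys} 0<ys xs<1 xs<ys =
  let q , l<q , q<u = ℚ.<-dense l<u in
  ⟨ q , ℚ.≤-<-trans (⊥≤max 0ℚ xs) l<q , ℚ.<-≤-trans q<u (min≤⊤ 1ℚ ys) ⟩ ,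
  All.map (λ x≤l → ℚ.≤-<-trans x≤l l<q) (xs≤max 0ℚ xs) ,
  All.map (ℚ.<-≤-trans q<u) (min≤xs 1ℚ ys)
  where
  strict : ∀ {p q} → p ℚ.< q → p ℚ.≤ q × p ≢ q
  strict p<q = ℚ.<⇒≤ p<q , ℚ.<⇒≢ p<q

  strict⁻¹ : ∀ {p q} → p ℚ.≤ q × p ≢ q → p ℚ.< q
  strict⁻¹ (p≤q , p≢q) = ℚ.≰⇒> λ q≤p → p≢q (ℚ.≤-antisym p≤q q≤p)

  l<u : max 0ℚ xs ℚ.< min 1ℚ ys
  l<u = strict⁻¹ (max<v⁺
    (v<min⁺ (strict (ℚ.positive⁻¹ 1ℚ)) (All.map strict 0<ys))
    (All.zipWith (λ (x<1 , x<ys) → v<min⁺ (strict x<1) (All.map strict x<ys)) (xs<1 , xs<ys)))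

<⇒≱ : ∀ {p q} → p ℚ.< q → ¬ (q ℚ.≤ p)
<⇒≱ p<q q≤p = ℚ.<-irrefl refl (ℚ.<-≤-trans p<q q≤p)

p-q+q≡p : ∀ p q → (p ℚ.- q) ℚ.+ q ≡ p
p-q+q≡p p q = trans (ℚ.+-assoc p (ℚ.- q) q)
  (trans (cong (p ℚ.+_) (ℚ.+-inverseˡ q)) (ℚ.+-identityʳ p))

∁+≤1 : ∀ (p : 𝕀) {q} → q ℚ.≤ val p → val (∁ p) ℚ.+ q ℚ.≤ 1ℚ
∁+≤1 p {q} q≤p = ℚ.≤-trans (ℚ.+-monoʳ-≤ (val (∁ p)) q≤p) (ℚ.≤-reflexive (p-q+q≡p 1ℚ (val p)))

∁+≤1⁻¹ : ∀ (p : 𝕀) {q} → val (∁ p) ℚ.+ q ℚ.≤ 1ℚ → q ℚ.≤ val p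
∁+≤1⁻¹ p {q} le = ℚ.≮⇒≥ λ p<q → ℚ.<-irrefl refl (ℚ.<-≤-trans
  (subst (ℚ._< val (∁ p) ℚ.+ q) (p-q+q≡p 1ℚ (val p)) (ℚ.+-monoʳ-< (val (∁ p)) p<q)) le)

∁-cancel-≤ : ∀ (p q : 𝕀) → val (∁ p) ℚ.≤ val (∁ q) → val q ℚ.≤ val p
∁-cancel-≤ p q le = ∁+≤1⁻¹ p (ℚ.≤-trans (ℚ.+-monoˡ-≤ (val q) le) (∁+≤1 q ℚ.≤-refl))

∁-mono-≤ : ∀ (p q : 𝕀) → val q ℚ.≤ val p → val (∁ p) ℚ.≤ val (∁ q)
∁-mono-≤ p q q≤p = ℚ.+-monoʳ-≤ 1ℚ (ℚ.neg-antimono-≤ q≤p)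

-- Cut t h says that from phase t on, the slots below h are separated from the others.
module Game
  (r d : ℕ) (r²≤d : r * r ≤ d) (κ : 𝕀)
  (A : OnlineAlgorithm (suc d))
  (Cut : ℕ → ℕ → Set) (Cut-mono : ∀ {s t h} → s ≤ t → Cut s h → Cut t h)
  where

  open Vectors r d r²≤d κ public
  open OnlineAlgorithm A using (strategy; feasible)

  data Played : List Entry → Set where
    []  : Played []
    _∷_ : ∀ {e E} → bin e ≡ strategy (input E) (toItem (shape e)) → Played E → Played (e ∷ E)

  played-assigned : ∀ {E} → Played E → ∀ i → assigned strategy (input E) i ≡ label bin E i
  played-assigned (eq ∷ p) zero    = sym eq
  played-assigned (eq ∷ p) (suc i) = played-assigned p i

  played-feasible : ∀ {E} → Played E → Feasible (input E) (label bin E)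
  played-feasible {E} p k c = subst (ℚ._≤ 1ℚ)
    (load-cong (input E) c (λ i → trans (sym (played-assigned p i))) (λ i → trans (played-assigned p i)))
    (feasible (input E) k c)

  played⇒total≤1 : ∀ {E} → Played E → ∀ k {δ} → Valid r δ → total δ (content bin E k) ℚ.≤ 1ℚ
  played⇒total≤1 {E} p = feasible⇒total≤1 E (label bin E) (played-feasible p)

  -- Only the item that opened the bin is large, so these bins can be counted by their large items.
  data TinyBin : List Entry → Set where
    first : ∀ {v i k} → TinyBin (large v i k ∷ [])
    more  : ∀ {v i k E} → TinyBin E → TinyBin (small v i k ∷ E)

  Separated : ℕ → ℕ → ℕ → Set
  Separated t i j = ∃[ h ] Cut t h × ((i < h × h ≤ j) ⊎ (j < h × h ≤ i))

  -- Two big items in a bin close it for all phases after that of the newer one: from then on a cut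
  -- lies between their slots, so no class contains both.
  data BinOK : List Entry → Set where
    empty : BinOK []
    tiny  : ∀ {E} → TinyBin E → BinOK E
    one   : ∀ {b i k} → BinOK (big b i k ∷ [])
    two   : ∀ {b b′ i i′ k k′} → Separated (suc (phase b)) i i′ →
            BinOK (big b i k ∷ big b′ i′ k′ ∷ [])

  total-∈ : ∀ δ {e E} → e ∈ E → value (coord (shape e) δ) ℚ.≤ total δ E
  total-∈ δ {E = e ∷ E} (here refl) = subst (ℚ._≤ total δ (e ∷ E)) (ℚ.+-identityʳ _)
    (ℚ.+-monoʳ-≤ (value (coord (shape e) δ)) (0≤total δ E))
  total-∈ δ {E = e ∷ E} (there x∈E) = subst (ℚ._≤ total δ (e ∷ E)) (ℚ.+-identityˡ _)
    (ℚ.+-mono-≤ (0≤value (coord (shape e) δ)) (total-∈ δ x∈E))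

  Fresh : ℕ → ℕ → List Entry → Set
  Fresh t j E = ∀ {b i k} → big b i k ∈ E → phase b ≡ t → i ≢ j

  Monotone : List Entry → Set
  Monotone E = ∀ {b i k b′ i′ k′} → big b i k ∈ E → big b′ i′ k′ ∈ E → phase b ≡ phase b′ →
    i < i′ → val (pos b) ℚ.< val (pos b′)

  select : ∀ {P : ℕ → Set} → ℕ → Decidable P → List Entry → List ℚ
  select s P? []              = []
  select s P? (big b i k ∷ E) with phase b ≟ s | P? i
  ... | yes _ | yes _ = val (pos b) ∷ select s P? E
  ... | _     | _     = select s P? E
  select s P? (_ ∷ E)         = select s P? E

  All-select⁺ : ∀ {P : ℕ → Set} s (P? : Decidable P) {Q : ℚ → Set} E →
    (∀ {b i k} → big b i k ∈ E → phase b ≡ s → P i → Q (val (pos b))) → All Q (select s P? E)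
  All-select⁺ s P? []                all = []
  All-select⁺ s P? (big b i k ∷ E)   all with phase b ≟ s | P? i
  ... | yes eq | yes p = all (here refl) eq p ∷ All-select⁺ s P? E (all ∘ there)
  ... | yes _  | no _  = All-select⁺ s P? E (all ∘ there)
  ... | no _   | _     = All-select⁺ s P? E (all ∘ there)
  All-select⁺ s P? (small _ _ _ ∷ E) all = All-select⁺ s P? E (all ∘ there)
  All-select⁺ s P? (large _ _ _ ∷ E) all = All-select⁺ s P? E (all ∘ there)

  All-select⁻ : ∀ {P : ℕ → Set} s (P? : Decidable P) {Q : ℚ → Set} E → All Q (select s P? E) →
    ∀ {b i k} → big b i k ∈ E → phase b ≡ s → P i → Q (val (pos b))
  All-select⁻ s P? (big b i k ∷ E)   qs       x∈E         eq p with phase b ≟ s | P? i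
  All-select⁻ s P? (big b i k ∷ E)   (q ∷ qs) (here refl) eq p | yes _ | yes _ = q
  All-select⁻ s P? (big b i k ∷ E)   (q ∷ qs) (there x∈E) eq p | yes _ | yes _ = All-select⁻ s P? E qs x∈E eq p
  All-select⁻ s P? (big b i k ∷ E)   qs       (here refl) eq p | yes _ | no ¬p = contradiction p ¬p
  All-select⁻ s P? (big b i k ∷ E)   qs       (there x∈E) eq p | yes _ | no _  = All-select⁻ s P? E qs x∈E eq p
  All-select⁻ s P? (big b i k ∷ E)   qs       (here refl) eq p | no ¬q | _     = contradiction eq ¬q
  All-select⁻ s P? (big b i k ∷ E)   qs       (there x∈E) eq p | no _  | _     = All-select⁻ s P? E qs x∈E eq p
  All-select⁻ s P? (small _ _ _ ∷ E) qs       (there x∈E) eq p = All-select⁻ s P? E qs x∈E eq p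
  All-select⁻ s P? (large _ _ _ ∷ E) qs       (there x∈E) eq p = All-select⁻ s P? E qs x∈E eq p

  -- By monotonicity every position of a slot below `c` is less than every position of a slot from
  -- `c` on, so `separate` applies.
  threshold : ∀ {E} → Monotone E → ∀ s c → Σ[ q ∈ 𝕀 ] (∀ {b i k} → big b i k ∈ E → phase b ≡ s →
    (i < c → val (pos b) ℚ.< val q) × (c ≤ i → val q ℚ.< val (pos b)))
  threshold {E} mono s c =
    let q , lows , highs = separate
          (All-select⁺ s (c ≤?_) E (λ {b} _ _ _ → 0<val (pos b)))
          (All-select⁺ s (_<? c) E (λ {b} _ _ _ → val<1 (pos b)))
          (All-select⁺ s (_<? c) E λ x∈E eq i<c → All-select⁺ s (c ≤?_) E λ y∈E eq′ c≤i →
            mono x∈E y∈E (trans eq (sym eq′)) (ℕ.<-≤-trans i<c c≤i))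
    in q , λ x∈E eq → All-select⁻ s (_<? c) E lows x∈E eq , All-select⁻ s (c ≤?_) E highs x∈E eq

  -- M is the number of slots for big items, N that of all slots, and a separates
  -- the small from the large items.
  module Phases (M N : ℕ) (M≤N : M ≤ N) (a : 𝕀) (a<½ : val a ℚ.< ½) (#tinies #larges : ℕ) where

    -- The fields `diag≤a` and `pair≤` keep room in the slots for phases still missing there.
    -- Bounding by an arbitrary `q` in `pair≤` treats slots with and without an item of phase `s`
    -- alike: the bound is its distance in one case and 0 in the other.
    record Invariant (E : List Entry) : Set where
      field
        played   : Played E
        bins-ok  : ∀ k → BinOK (content bin E k)
        heavy    : ∀ {v i k} → large v i k ∈ E → val a ℚ.< val v
        monotone : Monotone E
        slots≤1  : ∀ j {δ} → Valid r δ → total δ (content slot E j) ℚ.≤ 1ℚ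
        diag≤a   : ∀ {j t} → j < M → Fresh t j E → total (diag t) (content slot E j) ℚ.≤ val a
        pair≤    : ∀ σ {j s u} q → j < M → s < u → Fresh u j E → 0ℚ ℚ.≤ q →
                   (∀ {b i k} → big b i k ∈ E → phase b ≡ s → i ≡ j → val (distance b σ) ℚ.≤ q) →
                   total (pair σ s u) (content slot E j) ℚ.≤ q
        slots<N  : ∀ {e} → e ∈ E → slot e < N
        tinies≡  : sum tinies E ≡ #tinies
        larges≡  : sum larges E ≡ #larges

    open Invariant

    -- A big item that fits with exactly the earlier big items in the slots of
    -- [c₀, c₁[, and whose position is right for the slots of [i₀, i₁].
    record Probe (E : List Entry) (t c₀ c₁ i₀ i₁ : ℕ) (b : BigShape r) : Set where
      field
        phase≡ : phase b ≡ t
        α≡     : α b ≡ ∁ a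
        accept : ∀ σ {x j k} → big x j k ∈ E → c₀ ≤ j → j < c₁ →
                 val (distance x σ) ℚ.≤ val (limit b σ (phase x))
        reject : ∀ {x j k} → big x j k ∈ E →
                 (∀ σ → val (distance x σ) ℚ.≤ val (limit b σ (phase x))) → c₀ ≤ j × j < c₁
        above  : ∀ {x j k} → big x j k ∈ E → phase x ≡ t → j < i₀ → val (pos x) ℚ.< val (pos b)
        below  : ∀ {x j k} → big x j k ∈ E → phase x ≡ t → i₁ < j → val (pos b) ℚ.< val (pos x)

    ½<∁a : ½ ℚ.< val (∁ a)
    ½<∁a = ℚ.+-monoʳ-< 1ℚ (ℚ.neg-antimono-< a<½)

    probe : ∀ {E} → Monotone E → ∀ {t} → t < r → ∀ c₀ c₁ {i₀ i₁} → i₀ ≤ i₁ →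
      ∃ (Probe E t c₀ c₁ i₀ i₁)
    probe {E} mono {t} t<r c₀ c₁ {i₀} {i₁} i₀≤i₁ = b , record
      { phase≡ = refl
      ; α≡     = refl
      ; accept = accept
      ; reject = λ {x} x∈E fit →
          (ℕ.≮⇒≥ λ j<c₀ → <⇒≱ (proj₁ (cut x c₀ x∈E refl) j<c₀)
            (∁-cancel-≤ (pos x) (q (phase x) c₀) (fit right))) ,
          (ℕ.≰⇒> λ c₁≤j → <⇒≱ (proj₂ (cut x c₁ x∈E refl) c₁≤j) (fit left))
      ; above  = λ x∈E eq → proj₁ (proj₂ (threshold mono t i₀) x∈E eq)
      ; below  = λ x∈E eq i₁<j →
          proj₂ (proj₂ (threshold mono t i₀) x∈E eq) (ℕ.≤-trans i₀≤i₁ (ℕ.<⇒≤ i₁<j))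
      }
      where
      q : ℕ → ℕ → 𝕀
      q s c = proj₁ (threshold mono s c)

      cut : ∀ x c {j k} → big x j k ∈ E → phase x ≡ phase x →
        (j < c → val (pos x) ℚ.< val (q (phase x) c)) × (c ≤ j → val (q (phase x) c) ℚ.< val (pos x))
      cut x c = proj₂ (threshold mono (phase x) c)

      b : BigShape r
      b = record
        { phase  = t
        ; phase< = t<r
        ; α      = ∁ a
        ; ½<α    = ½<∁a
        -- The position is fixed before the slot; it exceeds those of the slots below `i₀` and is
        -- less than those beyond `i₁`, so it suits both ends.
        ; pos    = q t i₀
        -- A position of at most the threshold at `c₁` means a slot below `c₁`; dually, a complement
        -- of at most that of the threshold at `c₀` means a slot from `c₀` on.
        ; limit  = λ { left s → q s c₁ ; right s → ∁ (q s c₀) }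
        }

      accept : ∀ σ {x j k} → big x j k ∈ E → c₀ ≤ j → j < c₁ →
        val (distance x σ) ℚ.≤ val (limit b σ (phase x))
      accept left  {x} x∈E c₀≤j j<c₁ = ℚ.<⇒≤ (proj₁ (cut x c₁ x∈E refl) j<c₁)
      accept right {x} x∈E c₀≤j j<c₁ =
        ∁-mono-≤ (pos x) (q (phase x) c₀) (ℚ.<⇒≤ (proj₂ (cut x c₀ x∈E refl) c₀≤j))

    -- This closes the bin to big items, which take `1 - a` in the component of their phase.
    tinyBin-heavy : ∀ {E} t → TinyBin E → (∀ {v i k} → large v i k ∈ E → val a ℚ.< val v) →
      val a ℚ.< total (diag t) E
    tinyBin-heavy t first               heavy =
      ℚ.<-≤-trans (heavy (here refl)) (ℚ.≤-reflexive (sym (ℚ.+-identityʳ _)))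
    tinyBin-heavy t (more {v} {E = E} tb) heavy = ℚ.<-≤-trans (tinyBin-heavy t tb (heavy ∘ there))
      (subst (ℚ._≤ val v ℚ.+ total (diag t) E) (ℚ.+-identityˡ _)
        (ℚ.+-monoˡ-≤ (total (diag t) E) (ℚ.<⇒≤ (0<val v))))

    -- The slot is chosen on the other side of h than that of the big item that
    -- is already in the bin.
    place : ∀ {E t c₀ c₁ h i₀ i₁ b} → t < r →
      (∀ {v i k} → large v i k ∈ E → val a ℚ.< val v) →
      (∀ {x j k} → big x j k ∈ E → phase x ≤ t) →
      (∀ {h} → Cut t h → c₀ < h → ¬ (h < c₁)) → Cut (suc t) h → i₀ < h → h ≤ i₁ →
      Probe E t c₀ c₁ i₀ i₁ b →
      ∀ k {C} → (∀ {e} → e ∈ C → e ∈ E) → BinOK C →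
      (∀ {δ} → Valid r δ → value (coord (big b) δ) ℚ.+ total δ C ℚ.≤ 1ℚ) →
      ∃[ i ] (i ≡ i₀ ⊎ i ≡ i₁) × BinOK (big b i k ∷ C)
    place {E} {t} {c₀} {c₁} {h} {i₀} {i₁} {b} t<r heavy until noCut cut i₀<h h≤i₁ P k {C} C⊆E ok fit =
      go ok C⊆E light inside
      where
      open Probe P

      own : value (coord (big b) (diag t)) ≡ val (∁ a)
      own = trans (cong (λ s → value (coord (big b) (diag s))) (sym phase≡))
                  (trans (cong value (diag-own b)) (cong val α≡))

      -- The new item leaves only `a` in its phase component, which is less than ½: too little for a
      -- large item or another big one of this phase.
      light : total (diag t) C ℚ.≤ val a
      light = ∁+≤1⁻¹ a (subst (λ p → p ℚ.+ total (diag t) C ℚ.≤ 1ℚ) own (fit (diag t<r)))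

      ½≰a : ∀ {q} → ½ ℚ.< q → ¬ (q ℚ.≤ val a)
      ½≰a ½<q q≤a = ℚ.<-asym a<½ (ℚ.<-≤-trans ½<q q≤a)

      inside : ∀ {x j k} → big x j k ∈ C → phase x < t × c₀ ≤ j × j < c₁
      inside {x} {j} {k} x∈C = s<t , reject (C⊆E x∈C) dist
        where
        s≢t : phase x ≢ t
        s≢t refl = ½≰a (½<α x) (ℚ.≤-trans
          (ℚ.≤-trans (ℚ.≤-reflexive (sym (cong value (diag-own x)))) (total-∈ (diag t) x∈C)) light)

        s<t : phase x < t
        s<t = ℕ.≤∧≢⇒< (until (C⊆E x∈C)) s≢t

        dist : ∀ σ → val (distance x σ) ℚ.≤ val (limit b σ (phase x))
        dist σ = ℚ.≤-trans
          (ℚ.≤-trans (ℚ.≤-reflexive (sym (cong value (pair-own x σ t refl)))) (total-∈ (pair σ (phase x) t) x∈C))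
          (∁+≤1⁻¹ (limit b σ (phase x))
            (subst (λ m → value m ℚ.+ total (pair σ (phase x) t) C ℚ.≤ 1ℚ)
              (pair-later b σ (λ eq → s≢t (trans eq phase≡)) (sym phase≡))
              (fit (pair s<t t<r))))

      go : ∀ {C} → BinOK C → (∀ {e} → e ∈ C → e ∈ E) → total (diag t) C ℚ.≤ val a →
        (∀ {x j k} → big x j k ∈ C → phase x < t × c₀ ≤ j × j < c₁) →
        ∃[ i ] (i ≡ i₀ ⊎ i ≡ i₁) × BinOK (big b i k ∷ C)
      go empty _ _ _ = i₀ , inj₁ refl , one
      go (tiny tb) C⊆E light _ =
        contradiction light (<⇒≱ (tinyBin-heavy t tb (heavy ∘ C⊆E)))
      go (one {i = j}) _ _ _ with j <? h
      ... | yes j<h = i₁ , inj₂ refl , two (h , subst (λ s → Cut (suc s) h) (sym phase≡) cut , inj₂ (j<h , h≤i₁))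
      ... | no j≮h  = i₀ , inj₁ refl , two (h , subst (λ s → Cut (suc s) h) (sym phase≡) cut , inj₁ (i₀<h , ℕ.≮⇒≥ j≮h))
      -- Impossible: both slots would lie in `[c₀, c₁[`, and the cut between them, which is still
      -- one at phase `t`, would be interior to the class.
      go (two (h′ , cut′ , sep)) _ _ inside with inside (here refl) | inside (there (here refl)) | sep
      ... | s<t , c₀≤i , i<c₁ | _ , c₀≤j , j<c₁ | inj₁ (i<h′ , h′≤j) =
        contradiction (ℕ.≤-<-trans h′≤j j<c₁) (noCut (Cut-mono s<t cut′) (ℕ.≤-<-trans c₀≤i i<h′))
      ... | s<t , c₀≤i , i<c₁ | _ , c₀≤j , j<c₁ | inj₂ (j<h′ , h′≤i) =
        contradiction (ℕ.≤-<-trans h′≤i i<c₁) (noCut (Cut-mono s<t cut′) (ℕ.≤-<-trans c₀≤j j<h′))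

    between : ∀ {i i₀ i₁} → i₀ ≤ i₁ → i ≡ i₀ ⊎ i ≡ i₁ → i₀ ≤ i × i ≤ i₁
    between i₀≤i₁ (inj₁ refl) = ℕ.≤-refl , i₀≤i₁
    between i₀≤i₁ (inj₂ refl) = i₀≤i₁ , ℕ.≤-refl

    extend : ∀ {E t c₀ c₁ i₀ i₁ b} → Invariant E → t < r → c₁ ≤ M →
      (∀ {x j k} → big x j k ∈ E → phase x ≤ t) →
      (∀ {x j k} → big x j k ∈ E → phase x ≡ t → j < i₀ ⊎ i₁ < j) →
      i₀ ≤ i₁ → c₀ ≤ i₀ → i₁ < c₁ →
      Probe E t c₀ c₁ i₀ i₁ b →
      ∀ i k → i ≡ i₀ ⊎ i ≡ i₁ → k ≡ strategy (input E) (toItem (big b)) →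
      BinOK (big b i k ∷ content bin E k) → Invariant (big b i k ∷ E)
    extend {E} {t} {c₀} {c₁} {i₀} {i₁} {b} I t<r c₁≤M until gap i₀≤i₁ c₀≤i₀ i₁<c₁ P i k i≡ k≡ ok = record
      { played   = k≡ ∷ I .played
      ; bins-ok  = bins-ok′
      ; heavy    = λ { (there x∈E) → I .heavy x∈E }
      ; monotone = monotone′
      ; slots≤1  = slots≤1′
      ; diag≤a   = diag≤a′
      ; pair≤    = pair≤′
      ; slots<N  = λ { (here refl) → ℕ.<-≤-trans i<c₁ (ℕ.≤-trans c₁≤M M≤N) ; (there e∈E) → I .slots<N e∈E }
      ; tinies≡  = I .tinies≡
      ; larges≡  = I .larges≡
      }
      where
      open Probe P
      z = big b i k

      i₀≤i = proj₁ (between i₀≤i₁ i≡)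
      i≤i₁ = proj₂ (between i₀≤i₁ i≡)
      c₀≤i = ℕ.≤-trans c₀≤i₀ i₀≤i
      i<c₁ = ℕ.≤-<-trans i≤i₁ i₁<c₁
      i<M  = ℕ.<-≤-trans i<c₁ c₁≤M

      fresh : ∀ {x j k} → big x j k ∈ E → phase x ≡ t → j ≢ i
      fresh x∈E eq refl with gap x∈E eq
      ... | inj₁ i<i₀ = ℕ.<⇒≱ i<i₀ i₀≤i
      ... | inj₂ i₁<i = ℕ.<⇒≱ i₁<i i≤i₁

      later : ∀ {u} → t < u → ∀ {j} → Fresh u j E
      later t<u x∈E refl = contradiction (until x∈E) (ℕ.<⇒≱ t<u)

      bins-ok′ : ∀ k′ → BinOK (content bin (z ∷ E) k′)
      bins-ok′ k′ = content-elim BinOK bin z E (λ { refl → ok }) (λ _ → I .bins-ok k′)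

      monotone′ : Monotone (z ∷ E)
      monotone′ (here refl) (here refl) _ i<i = contradiction i<i (ℕ.<-irrefl refl)
      monotone′ (here refl) (there y∈E) eq i<j with gap y∈E (trans (sym eq) phase≡)
      ... | inj₁ j<i₀ = contradiction (ℕ.<-trans i<j j<i₀) (ℕ.≤⇒≯ i₀≤i)
      ... | inj₂ i₁<j = below y∈E (trans (sym eq) phase≡) i₁<j
      monotone′ (there x∈E) (here refl) eq j<i with gap x∈E (trans eq phase≡)
      ... | inj₁ j<i₀ = above x∈E (trans eq phase≡) j<i₀
      ... | inj₂ i₁<j = contradiction (ℕ.<-trans i₁<j j<i) (ℕ.≤⇒≯ i≤i₁)
      monotone′ (there x∈E) (there y∈E) = I .monotone x∈E y∈E

      absent : ∀ δ C {q} → coord (big b) δ ≡ nothing → total δ C ℚ.≤ q → total δ (z ∷ C) ℚ.≤ q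
      absent δ C {q} eq le = subst (λ m → value m ℚ.+ total δ C ℚ.≤ q) (sym eq)
        (subst (ℚ._≤ q) (sym (ℚ.+-identityˡ _)) le)

      present : ∀ δ C {p q} → coord (big b) δ ≡ just p → val p ℚ.+ total δ C ℚ.≤ q → total δ (z ∷ C) ℚ.≤ q
      present δ C {p} {q} eq = subst (λ m → value m ℚ.+ total δ C ℚ.≤ q) (sym eq)

      slots≤1′ : ∀ j {δ} → Valid r δ → total δ (content slot (z ∷ E) j) ℚ.≤ 1ℚ
      slots≤1′ j {δ} v = content-elim (λ C → total δ C ℚ.≤ 1ℚ) slot z E
        (λ { refl → new v }) (λ _ → I .slots≤1 j v)
        where
        rest : List Entry
        rest = content slot E i

        new-diag : ∀ {s} → s < r → Dec (s ≡ phase b) → total (diag s) (z ∷ rest) ℚ.≤ 1ℚ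
        new-diag {s} s<r (no s≢)    = absent (diag s) rest (diag-other b s≢) (I .slots≤1 i (diag s<r))
        new-diag {s} s<r (yes refl) = present (diag s) rest (trans (diag-own b) (cong just α≡))
          (∁+≤1 a (I .diag≤a i<M λ x∈E eq → fresh x∈E (trans eq phase≡)))

        new-pair : ∀ {σ s u} → s < u → u < r → Dec (s ≡ phase b) → Dec (u ≡ phase b) →
          total (pair σ s u) (z ∷ rest) ℚ.≤ 1ℚ
        new-pair {σ} {s} {u} s<u u<r (no s≢) (no u≢) = absent (pair σ s u) rest
          (pair-other b σ s≢ u≢) (I .slots≤1 i (pair s<u u<r))
        -- The slot lies in `[c₀, c₁[`, so `accept` bounds its distance of phase `s` by the limit,
        -- whose complement is added here.
        new-pair {σ} {s} {u} s<u u<r (no s≢) (yes refl) = present (pair σ s u) rest (pair-later b σ s≢ refl)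
          (∁+≤1 (limit b σ s) (I .pair≤ σ (val (limit b σ s)) i<M s<u
            (λ x∈E eq → fresh x∈E (trans eq phase≡))
            (ℚ.<⇒≤ (0<val (limit b σ s)))
            λ { x∈E refl refl → accept σ x∈E c₀≤i i<c₁ }))
        -- The slot has neither another item of this phase nor one of the later phase `u`, so the
        -- component was empty before.
        new-pair {σ} {s} {u} s<u u<r (yes refl) _ = present (pair σ s u) rest (pair-own b σ u refl)
          (ℚ.+-mono-≤ (ℚ.<⇒≤ (val<1 (distance b σ)))
            (I .pair≤ σ 0ℚ i<M s<u (later (subst (_< u) phase≡ s<u)) ℚ.≤-refl
              λ x∈E eq j≡i → contradiction j≡i (fresh x∈E (trans eq phase≡))))

        new : ∀ {δ} → Valid r δ → total δ (z ∷ rest) ℚ.≤ 1ℚ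
        new card                       = absent card rest refl (I .slots≤1 i card)
        new (diag {s} s<r)             = new-diag s<r (s ≟ phase b)
        new (pair {s = s} {u} s<u u<r) = new-pair s<u u<r (s ≟ phase b) (u ≟ phase b)

      diag≤a′ : ∀ {j s} → j < M → Fresh s j (z ∷ E) → total (diag s) (content slot (z ∷ E) j) ℚ.≤ val a
      diag≤a′ {j} {s} j<M freshₛ = content-elim (λ C → total (diag s) C ℚ.≤ val a) slot z E
        (λ { refl → absent (diag s) (content slot E j) (diag-other b λ s≡ → freshₛ (here refl) (sym s≡) refl) old })
        (λ _ → old)
        where
        old = I .diag≤a j<M (freshₛ ∘ there)

      pair≤′ : ∀ σ {j s u} q → j < M → s < u → Fresh u j (z ∷ E) → 0ℚ ℚ.≤ q →
        (∀ {x i k} → big x i k ∈ z ∷ E → phase x ≡ s → i ≡ j → val (distance x σ) ℚ.≤ q) →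
        total (pair σ s u) (content slot (z ∷ E) j) ℚ.≤ q
      pair≤′ σ {j} {s} {u} q j<M s<u freshᵤ 0≤q bound =
        content-elim (λ C → total (pair σ s u) C ℚ.≤ q) slot z E
          (λ i≡j → new i≡j (s ≟ phase b)) (λ _ → old)
        where
        old = I .pair≤ σ q j<M s<u (freshᵤ ∘ there) 0≤q (bound ∘ there)

        new : i ≡ j → Dec (s ≡ phase b) → total (pair σ s u) (z ∷ content slot E j) ℚ.≤ q
        new refl (no s≢)    = absent (pair σ s u) (content slot E j)
          (pair-other b σ s≢ λ u≡ → freshᵤ (here refl) (sym u≡) refl) old
        -- The new item is the only one of the slot in this component, so its own distance is the
        -- whole total.
        new refl (yes refl) = present (pair σ s u) (content slot E j) (pair-own b σ u refl)
          (subst (val (distance b σ) ℚ.+ total (pair σ s u) (content slot E j) ℚ.≤_) (ℚ.+-identityʳ q)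
            (ℚ.+-mono-≤ (bound (here refl) refl refl)
              (I .pair≤ σ 0ℚ j<M s<u (freshᵤ ∘ there) ℚ.≤-refl
                λ x∈E eq j≡i → contradiction j≡i (fresh x∈E (trans eq phase≡)))))

    step : ∀ {E t c₀ c₁ h i₀ i₁} → Invariant E → t < r → c₁ ≤ M →
      (∀ {x j k} → big x j k ∈ E → phase x ≤ t) →
      (∀ {x j k} → big x j k ∈ E → phase x ≡ t → j < i₀ ⊎ i₁ < j) →
      (∀ {h} → Cut t h → c₀ < h → ¬ (h < c₁)) → Cut (suc t) h →
      c₀ ≤ i₀ → i₀ < h → h ≤ i₁ → i₁ < c₁ →
      ∃[ b ] ∃[ i ] ∃[ k ] Invariant (big b i k ∷ E) × phase b ≡ t × (i ≡ i₀ ⊎ i ≡ i₁)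
    step {E} {c₀ = c₀} {c₁} I t<r c₁≤M until gap noCut cut c₀≤i₀ i₀<h h≤i₁ i₁<c₁ =
      b , i , k , extend I t<r c₁≤M until gap i₀≤i₁ c₀≤i₀ i₁<c₁ P i k i≡ refl ok , Probe.phase≡ P , i≡
      where
      i₀≤i₁  = ℕ.≤-trans (ℕ.<⇒≤ i₀<h) h≤i₁
      probed = probe (I .monotone) t<r c₀ c₁ i₀≤i₁
      b      = proj₁ probed
      P      = proj₂ probed
      -- The vector of `b` does not involve a slot, so the answer of the algorithm is known before
      -- the slot is chosen.
      k = strategy (input E) (toItem (big b))

      chosen = place t<r (I .heavy) until noCut cut i₀<h h≤i₁ P k
        (proj₁ ∘ content-⊆ bin E) (I .bins-ok k)
        -- Slot 0 is a placeholder: the totals of a bin do not depend on slots.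
        λ {δ} v → subst (λ C → total δ C ℚ.≤ 1ℚ) (content-hit bin (big b 0 k) E refl)
          (played⇒total≤1 {big b 0 k ∷ E} (refl ∷ I .played) k v)
      i  = proj₁ chosen
      i≡ = proj₁ (proj₂ chosen)
      ok = proj₂ (proj₂ chosen)

-- The phases of big items

-- In phase t the slots are divided into classes of level t slots each, and every
-- class is bisected D times.
module Levels (r c D : ℕ) where

  g : ℕ
  g = 2 ^ D

  level : ℕ → ℕ
  level t = c * g ^ (r ∸ t)

  Cut : ℕ → ℕ → Set
  Cut t h = level t ∣ h

  -- Each class is a union of classes of any later phase; hence cuts persist.
  level-antitone-∣ : ∀ {s t} → s ≤ t → level t ∣ level s
  level-antitone-∣ {s} {t} s≤t = *-monoʳ-∣ c (divides (g ^ (r ∸ s ∸ (r ∸ t)))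
    (trans (cong (g ^_) (sym (ℕ.m∸n+n≡m (ℕ.∸-monoʳ-≤ r s≤t))))
           (ℕ.^-distribˡ-+-* g (r ∸ s ∸ (r ∸ t)) (r ∸ t))))

  Cut-mono : ∀ {s t h} → s ≤ t → Cut s h → Cut t h
  Cut-mono s≤t = ∣-trans (level-antitone-∣ s≤t)

  level-suc : ∀ {t} → t < r → level t ≡ g * level (suc t)
  level-suc {t} t<r = trans
    (cong (λ e → c * g ^ e) (ℕ.+-∸-assoc 1 t<r))
    (x∙yz≈y∙xz c g (g ^ (r ∸ suc t)))

  level-^ : ∀ {t} → t ≤ r → g ^ t * level t ≡ level 0
  level-^ {t} t≤r = trans (x∙yz≈y∙xz (g ^ t) c (g ^ (r ∸ t)))
    (cong (c *_) (trans (sym (ℕ.^-distribˡ-+-* g t (r ∸ t))) (cong (g ^_) (ℕ.m+[n∸m]≡n t≤r))))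

module Adversary
  (r d : ℕ) (r²≤d : r * r ≤ d) (κ : 𝕀) (A : OnlineAlgorithm (suc d)) (c D : ℕ) where

  open Levels r c D public
  open Game r d r²≤d κ A Cut Cut-mono public

  module Run (N : ℕ) (M≤N : level 0 ≤ N) (a : 𝕀) (a<½ : val a ℚ.< ½) (#tinies #larges : ℕ) where

    open Phases (level 0) N M≤N a a<½ #tinies #larges public

    Until Before : ℕ → List Entry → Set
    Until  t E = ∀ {x j k} → big x j k ∈ E → phase x ≤ t
    Before t E = ∀ {x j k} → big x j k ∈ E → phase x < t

    Below : ℕ → ℕ → List Entry → Set
    Below t X E = ∀ {x j k} → big x j k ∈ E → phase x ≡ t → j < X

    -- `w` counts the free slots at hand, and `loss` bounds those among them that stay empty. The
    -- field `below` tells that the new items of phase `t` stay below `X`, which keeps the following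
    -- classes free.
    record Filled (E : List Entry) (t X w loss : ℕ) : Set where
      field
        {entries} : List Entry
        invariant : Invariant entries
        until     : Until t entries
        below     : ∀ {Y} → X ≤ Y → Below t Y E → Below t Y entries
        count     : sum bigs E + w ≤ sum bigs entries + loss

    -- The slots of [a₀, a₀ + w[ do not yet have an item of phase t.
    fill : ∀ m w {E t c₀ c₁ a₀} → Invariant E → Until t E → t < r →
      level (suc t) ∣ c₀ → c₁ ≡ c₀ + 2 ^ m * level (suc t) →
      (∀ {h} → Cut t h → c₀ < h → ¬ (h < c₁)) → c₁ ≤ level 0 →
      c₀ ≤ a₀ → a₀ + w ≤ c₁ →
      (∀ {x j k} → big x j k ∈ E → phase x ≡ t → j < a₀ ⊎ a₀ + w ≤ j) →
      Filled E t (a₀ + w) w (level (suc t))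
    fill zero w {E} {t} {c₀} {c₁} {a₀} I until t<r n∣c₀ c₁≡ noCut c₁≤M c₀≤a₀ a₀+w≤c₁ gap = record
      { invariant = I
      ; until     = until
      ; below     = λ _ → id
      ; count     = ℕ.+-monoʳ-≤ (sum bigs E) w≤n
      }
      where
      -- After the last bisection the free slots lie in a single class of the next phase; they are
      -- given up.
      w≤n : w ≤ level (suc t)
      w≤n = ℕ.+-cancelˡ-≤ c₀ _ _ (begin
        c₀ + w                      ≤⟨ ℕ.+-monoˡ-≤ w c₀≤a₀ ⟩
        a₀ + w                      ≤⟨ a₀+w≤c₁ ⟩
        c₁                          ≡⟨ c₁≡ ⟩
        c₀ + 1 * level (suc t)      ≡⟨ cong (c₀ +_) (ℕ.*-identityˡ _) ⟩
        c₀ + level (suc t)          ∎)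
        where open ℕ.≤-Reasoning
    fill (suc m) zero {E} I until t<r n∣c₀ c₁≡ noCut c₁≤M c₀≤a₀ a₀+w≤c₁ gap = record
      { invariant = I
      ; until     = until
      ; below     = λ _ → id
      ; count     = ℕ.+-monoʳ-≤ (sum bigs E) z≤n
      }
    fill (suc m) (suc w) {E} {t} {c₀} {c₁} {a₀} I until t<r n∣c₀ c₁≡ noCut c₁≤M c₀≤a₀ a₀+w≤c₁ gap =
      -- If the free slots lie on one side of the middle `h`, the process continues in that half.
      -- Otherwise an item gets the first or the last of them, and the same class is continued with
      -- one slot fewer, so nothing is lost.
      [ (λ a₀+w<h → fill m (suc w) I until t<r n∣c₀ refl
          (λ cut c₀<h′ h′<h → noCut cut c₀<h′ (ℕ.<-≤-trans h′<h h≤c₁)) (ℕ.≤-trans h≤c₁ c₁≤M)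
          c₀≤a₀ a₀+w<h gap)
      , (λ h<a₀+w → [ (λ h≤a₀ → fill m (suc w) I until t<r n∣h c₁≡h+
                        (λ cut h<h′ → noCut cut (ℕ.≤-<-trans c₀≤h h<h′)) c₁≤M
                        h≤a₀ a₀+w≤c₁ gap)
                    , (λ a₀<h →
                        let b , i , k , I′ , phase≡ , i≡ =
                              step I t<r c₁≤M until gap′ noCut n∣h c₀≤a₀ a₀<h (h≤a₀+w h<a₀+w) a₀+w<c₁
                        in [ (λ i≡a₀ → low b i k I′ phase≡ i≡a₀
                               (fill (suc m) w I′ (until′ b i k phase≡) t<r n∣c₀ c₁≡ noCut c₁≤M
                                 (ℕ.m≤n⇒m≤1+n c₀≤a₀) a₀+w<c₁ (gap-low b i k i≡a₀)))
                           , (λ i≡a₀+w → high b i k I′ phase≡ i≡a₀+w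
                               (fill (suc m) w I′ (until′ b i k phase≡) t<r n∣c₀ c₁≡ noCut c₁≤M
                                 c₀≤a₀ (ℕ.<⇒≤ a₀+w<c₁) (gap-high b i k i≡a₀+w)))
                           ]′ i≡)
                    ]′ (ℕ.≤-<-connex h a₀))
      ]′ (ℕ.≤-<-connex (a₀ + suc w) h)
      where
      n = level (suc t)
      h = c₀ + 2 ^ m * n

      c₀≤h : c₀ ≤ h
      c₀≤h = ℕ.m≤m+n c₀ _

      c₁≡h+ : c₁ ≡ h + 2 ^ m * n
      c₁≡h+ = trans c₁≡ (double c₀ (2 ^ m) n)
        where
        double : ∀ c p n → c + (p + (p + 0)) * n ≡ c + p * n + p * n
        double = solve-∀

      h≤c₁ : h ≤ c₁
      h≤c₁ = ℕ.≤-trans (ℕ.m≤m+n h _) (ℕ.≤-reflexive (sym c₁≡h+))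

      n∣h : n ∣ h
      n∣h = ∣m∣n⇒∣m+n n∣c₀ (n∣m*n (2 ^ m))

      a₀+w<c₁ : a₀ + w < c₁
      a₀+w<c₁ = subst (_≤ c₁) (ℕ.+-suc a₀ w) a₀+w≤c₁

      h≤a₀+w : h < a₀ + suc w → h ≤ a₀ + w
      h≤a₀+w lt = s≤s⁻¹ (subst (h <_) (ℕ.+-suc a₀ w) lt)

      gap′ : ∀ {x j k} → big x j k ∈ E → phase x ≡ t → j < a₀ ⊎ a₀ + w < j
      gap′ {j = j} x∈E eq = Sum.map₂ (subst (_≤ j) (ℕ.+-suc a₀ w)) (gap x∈E eq)

      until′ : ∀ b i k → phase b ≡ t → Until t (big b i k ∷ E)
      until′ b i k eq (here refl) = ℕ.≤-reflexive eq
      until′ b i k eq (there x∈E) = until x∈E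

      gap-low : ∀ b i k → i ≡ a₀ → ∀ {x j l} → big x j l ∈ big b i k ∷ E → phase x ≡ t →
        j < suc a₀ ⊎ suc a₀ + w ≤ j
      gap-low b i k refl (here refl) eq = inj₁ ℕ.≤-refl
      gap-low b i k refl (there x∈E) eq = Sum.map₁ ℕ.m≤n⇒m≤1+n (gap′ x∈E eq)

      gap-high : ∀ b i k → i ≡ a₀ + w → ∀ {x j l} → big x j l ∈ big b i k ∷ E → phase x ≡ t →
        j < a₀ ⊎ a₀ + w ≤ j
      gap-high b i k refl (here refl) eq = inj₂ ℕ.≤-refl
      gap-high b i k refl (there x∈E) eq = Sum.map₂ ℕ.<⇒≤ (gap′ x∈E eq)

      finish : ∀ b i k {X} → X ≤ a₀ + suc w → i < a₀ + suc w →
        Filled (big b i k ∷ E) t X w n → Filled E t (a₀ + suc w) (suc w) n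
      finish b i k X≤ i< F = record
        { invariant = invariant
        ; until     = F.until
        ; below     = λ le lt → F.below (ℕ.≤-trans X≤ le)
                        λ { (here refl) _ → ℕ.<-≤-trans i< le ; (there x∈E) → lt x∈E }
        ; count     = subst (_≤ sum bigs entries + n) (sym (ℕ.+-suc (sum bigs E) w)) F.count
        }
        where
        module F = Filled F
        open F using (entries; invariant)

      low : ∀ b i k → Invariant (big b i k ∷ E) → phase b ≡ t → i ≡ a₀ →
        Filled (big b i k ∷ E) t (suc a₀ + w) w n → Filled E t (a₀ + suc w) (suc w) n
      low b i k _ _ refl = finish b i k (ℕ.≤-reflexive (sym (ℕ.+-suc a₀ w)))
        (ℕ.≤-trans (s≤s (ℕ.m≤m+n a₀ w)) (ℕ.≤-reflexive (sym (ℕ.+-suc a₀ w))))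

      high : ∀ b i k → Invariant (big b i k ∷ E) → phase b ≡ t → i ≡ a₀ + w →
        Filled (big b i k ∷ E) t (a₀ + w) w n → Filled E t (a₀ + suc w) (suc w) n
      high b i k _ _ refl = finish b i k (ℕ.+-monoʳ-≤ a₀ (ℕ.n≤1+n w)) (ℕ.+-monoʳ-< a₀ (ℕ.n<1+n w))

    -- The classes are filled from left to right. Each has `level t` slots, of which at most
    -- `level (suc t)` stay empty.
    classes : ∀ {E t} → Invariant E → Before t E → t < r → ∀ j → j ≤ g ^ t →
      ∃[ E′ ] Invariant E′ × Until t E′ × Below t (j * level t) E′ ×
        sum bigs E + j * level t ≤ sum bigs E′ + j * level (suc t)
    classes {E} I before t<r zero _ =
      E , I , ℕ.<⇒≤ ∘ before , (λ x∈E eq → contradiction eq (ℕ.<⇒≢ (before x∈E))) , ℕ.≤-refl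
    classes {E} {t} I before t<r (suc j) j<gᵗ =
      let E₁ , I₁ , until , below , count = classes I before t<r j (ℕ.<⇒≤ j<gᵗ)
          F = fill D m {a₀ = j * m} I₁ until t<r n∣jm refl noCut c₁≤M ℕ.≤-refl jm+m≤c₁
                (λ x∈E eq → inj₁ (below x∈E eq))
      in Filled.entries F , Filled.invariant F , Filled.until F ,
        Filled.below F (ℕ.≤-reflexive (ℕ.+-comm (j * m) m))
          (λ x∈E eq → ℕ.<-≤-trans (below x∈E eq) (ℕ.m≤n+m (j * m) m)) ,
        (begin
          sum bigs E + (m + j * m)                    ≡⟨ x∙yz≈xz∙y′ (sum bigs E) m (j * m) ⟩
          sum bigs E + j * m + m                      ≤⟨ ℕ.+-monoˡ-≤ m count ⟩
          sum bigs E₁ + j * n + m                     ≡⟨ xy∙z≈xz∙y′ (sum bigs E₁) (j * n) m ⟩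
          sum bigs E₁ + m + j * n                     ≤⟨ ℕ.+-monoˡ-≤ (j * n) (Filled.count F) ⟩
          sum bigs (Filled.entries F) + n + j * n     ≡⟨ ℕ.+-assoc _ n (j * n) ⟩
          sum bigs (Filled.entries F) + (n + j * n)   ∎)
      where
      open ℕ.≤-Reasoning
      m = level t
      n = level (suc t)
      m≡gn = level-suc t<r

      x∙yz≈xz∙y′ : ∀ x y z → x + (y + z) ≡ x + z + y
      x∙yz≈xz∙y′ = solve-∀

      xy∙z≈xz∙y′ : ∀ x y z → x + y + z ≡ x + z + y
      xy∙z≈xz∙y′ = solve-∀

      n∣jm : n ∣ j * m
      n∣jm = ∣-trans (level-antitone-∣ (ℕ.n≤1+n t)) (n∣m*n j)

      jm+m≤c₁ : j * m + m ≤ j * m + g * n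
      jm+m≤c₁ = ℕ.≤-reflexive (cong (j * m +_) m≡gn)

      c₁≡ : j * m + g * n ≡ suc j * m
      c₁≡ = trans (cong (j * m +_) (sym m≡gn)) (ℕ.+-comm (j * m) m)

      c₁≤M : j * m + g * n ≤ level 0
      c₁≤M = begin
        j * m + g * n ≡⟨ c₁≡ ⟩
        suc j * m     ≤⟨ ℕ.*-monoˡ-≤ m j<gᵗ ⟩
        g ^ t * m     ≡⟨ level-^ (ℕ.<⇒≤ t<r) ⟩
        level 0       ∎

      noCut : ∀ {h} → Cut t h → j * m < h → ¬ (h < j * m + g * n)
      noCut {h} (divides q refl) jm<h h<c₁ = ℕ.<⇒≱ (ℕ.*-cancelʳ-< m j q jm<h)
        (s≤s⁻¹ (ℕ.*-cancelʳ-< m q (suc j) (subst (q * m <_) c₁≡ h<c₁)))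

    -- Cleared of denominators, the count says that there are at least `t M (1 - 1/g)` big items:
    -- the `g ^ t` classes of phase `t` lose `level (suc t)` slots each, together `M / g`.
    phases : ∀ {E} → Invariant E → Before 0 E → ∀ t → t ≤ r →
      ∃[ E′ ] Invariant E′ × Before t E′ × t * (g * level 0) ≤ g * sum bigs E′ + t * level 0
    phases {E} I before zero _ = E , I , before , z≤n
    phases {E} I before (suc t) t<r =
      let E₁ , I₁ , before₁ , count₁   = phases I before t (ℕ.<⇒≤ t<r)
          E₂ , I₂ , until₂ , _ , count₂ = classes I₁ before₁ t<r (g ^ t) ℕ.≤-refl
      in E₂ , I₂ , s≤s ∘ until₂ , (begin
        g * M + t * (g * M)                                     ≤⟨ ℕ.+-monoʳ-≤ (g * M) count₁ ⟩
        g * M + (g * sum bigs E₁ + t * M)                       ≡⟨ cong (λ x → g * x + (g * sum bigs E₁ + t * M))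
                                                                        (level-^ (ℕ.<⇒≤ t<r)) ⟨
        g * (g ^ t * level t) + (g * sum bigs E₁ + t * M)       ≡⟨ regroup g (g ^ t * level t) (sum bigs E₁) (t * M) ⟩
        g * (sum bigs E₁ + g ^ t * level t) + t * M             ≤⟨ ℕ.+-monoˡ-≤ (t * M) (ℕ.*-monoʳ-≤ g count₂) ⟩
        g * (sum bigs E₂ + g ^ t * level (suc t)) + t * M       ≡⟨ regroup′ g (sum bigs E₂) (g ^ t) (level (suc t)) (t * M) ⟩
        g * sum bigs E₂ + (g ^ suc t * level (suc t) + t * M)   ≡⟨ cong (λ x → g * sum bigs E₂ + (x + t * M)) (level-^ t<r) ⟩
        g * sum bigs E₂ + (M + t * M)                           ∎)
      where
      open ℕ.≤-Reasoning
      M = level 0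

      regroup : ∀ g x y z → g * x + (g * y + z) ≡ g * (y + x) + z
      regroup = solve-∀

      regroup′ : ∀ g x p n z → g * (x + p * n) + z ≡ g * x + (g * p * n + z)
      regroup′ = solve-∀

-- The tiny items

-- weight n is so small that n more tiny items can be handled.
weight : ℕ → ℚ
weight zero    = 1ℚ
weight (suc n) = weight n ℚ.* (½ ℚ.* weight n)

0<* : ∀ {p q} → 0ℚ ℚ.< p → 0ℚ ℚ.< q → 0ℚ ℚ.< p ℚ.* q
0<* {p} {q} 0<p 0<q = ℚ.positive⁻¹ _ {{ℚ.pos*pos⇒pos p {{ℚ.positive 0<p}} q {{ℚ.positive 0<q}}}}

*-≤1 : ∀ {p q} → 0ℚ ℚ.≤ q → p ℚ.≤ 1ℚ → p ℚ.* q ℚ.≤ q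
*-≤1 {p} {q} 0≤q p≤1 = subst (p ℚ.* q ℚ.≤_) (ℚ.*-identityˡ q)
  (ℚ.*-monoʳ-≤-nonNeg q {{ℚ.nonNegative 0≤q}} p≤1)

0<½ : 0ℚ ℚ.< ½
0<½ = ℚ.positive⁻¹ ½

0<weight : ∀ n → 0ℚ ℚ.< weight n
0<weight zero    = ℚ.positive⁻¹ 1ℚ
0<weight (suc n) = 0<* (0<weight n) (0<* 0<½ (0<weight n))

½≤1 : ½ ℚ.≤ 1ℚ
½≤1 = ℚ.≤ᵇ⇒≤ _

weight≤1 : ∀ n → weight n ℚ.≤ 1ℚ
weight≤1 zero    = ℚ.≤-refl
weight≤1 (suc n) = ℚ.≤-trans (*-≤1 (ℚ.<⇒≤ (0<* 0<½ (0<weight n))) (weight≤1 n))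
  (ℚ.≤-trans (*-≤1 (ℚ.<⇒≤ (0<weight n)) ½≤1) (weight≤1 n))

½*p+½*p : ∀ p → ½ ℚ.* p ℚ.+ ½ ℚ.* p ≡ p
½*p+½*p p = trans (sym (ℚ.*-distribʳ-+ p ½ ½)) (ℚ.*-identityˡ p)

module TinyStage
  (r d : ℕ) (r²≤d : r * r ≤ d) (κ : 𝕀)
  (A : OnlineAlgorithm (suc d))
  (Cut : ℕ → ℕ → Set) (Cut-mono : ∀ {s t h} → s ≤ t → Cut s h → Cut t h)
  (M K : ℕ) (1<K : 1 < K) (K·κ≡1 : Vectors.multiple r d r²≤d κ K ≡ 1ℚ)
  where

  open Game r d r²≤d κ A Cut Cut-mono
  open OnlineAlgorithm A using (strategy)

  occupancy : List Entry → ℕ → ℕ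
  occupancy E j = sum tinies (content slot E j)

  -- Slots of one kind, selected by `R`, are filled in order; items of the other kind do not affect
  -- the cursor.
  Cursor : (ℕ → Set) → List Entry → ℕ → ℕ → Set
  Cursor R E q f = (R q → occupancy E q ≤ f) × (∀ j → q < j → R j → occupancy E j ≤ 0)

  -- Counting in base `K` with last digit `f`; a carry moves the cursor on to the next slot.
  advance : ∀ q f → f < K → ∃[ q′ ] ∃[ f′ ] f′ < K × q′ * K + f′ ≡ suc (q * K + f) ×
    ((q′ ≡ q × f′ ≡ suc f) ⊎ (q′ ≡ suc q))
  advance q f f<K with suc f ≟ K
  ... | yes eq   = suc q , 0 , ℕ.<-trans ℕ.0<1+n 1<K ,
    trans (carry K (q * K)) (trans (cong (q * K +_) (sym eq)) (ℕ.+-suc (q * K) f)) , inj₂ refl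
    where
    carry : ∀ K x → K + x + 0 ≡ x + K
    carry = solve-∀
  ... | no 1+f≢K = q , suc f , ℕ.≤∧≢⇒< f<K 1+f≢K , ℕ.+-suc (q * K) f , inj₁ (refl , refl)

  occupancy-hit : ∀ e {E} → tinies e ≡ 1 → occupancy (e ∷ E) (slot e) ≡ suc (occupancy E (slot e))
  occupancy-hit e {E} eq = trans (cong (sum tinies) (content-hit slot e E refl))
    (cong (_+ occupancy E (slot e)) eq)

  occupancy-miss : ∀ e {E j} → slot e ≢ j → occupancy (e ∷ E) j ≡ occupancy E j
  occupancy-miss e {E} neq = cong (sum tinies) (content-miss slot e E neq)

  cursor-here : ∀ {R E q f q′ f′} e → tinies e ≡ 1 → slot e ≡ q → R q → Cursor R E q f →
    (q′ ≡ q × f′ ≡ suc f) ⊎ (q′ ≡ suc q) → Cursor R (e ∷ E) q′ f′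
  cursor-here {E = E} {q} e t≡1 refl Rq (at , beyond) (inj₁ (refl , refl)) =
    (λ _ → subst (_≤ _) (sym (occupancy-hit e t≡1)) (s≤s (at Rq))) ,
    (λ j q<j Rj → subst (_≤ 0) (sym (occupancy-miss e (ℕ.<⇒≢ q<j))) (beyond j q<j Rj))
  cursor-here {E = E} {q} {f′ = f′} e t≡1 refl Rq (at , beyond) (inj₂ refl) =
    (λ R′ → subst (_≤ f′) (sym (occupancy-miss e (ℕ.<⇒≢ ℕ.≤-refl))) (ℕ.≤-trans (beyond (suc q) ℕ.≤-refl R′) z≤n)) ,
    (λ j q<j Rj → subst (_≤ 0) (sym (occupancy-miss e (ℕ.<⇒≢ (ℕ.<⇒≤ q<j)))) (beyond j (ℕ.<⇒≤ q<j) Rj))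

  cursor-elsewhere : ∀ {R E q f} e → ¬ R (slot e) → Cursor R E q f → Cursor R (e ∷ E) q f
  cursor-elsewhere {R} {E} e ¬R (at , beyond) =
    (λ Rq → subst (_≤ _) (sym (miss Rq)) (at Rq)) ,
    (λ j q<j Rj → subst (_≤ 0) (sym (miss Rj)) (beyond j q<j Rj))
    where
    miss : ∀ {j} → R j → occupancy (e ∷ E) j ≡ occupancy E j
    miss Rj = occupancy-miss e λ { refl → ¬R Rj }

  pair-empty : ∀ {σ s u} E → (∀ {b i k} → ¬ (big b i k ∈ E)) → total (pair σ s u) E ≡ 0ℚ
  pair-empty []                none = refl
  pair-empty (small _ _ _ ∷ E) none = trans (ℚ.+-identityˡ _) (pair-empty E (none ∘ there))
  pair-empty (large _ _ _ ∷ E) none = trans (ℚ.+-identityˡ _) (pair-empty E (none ∘ there))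
  pair-empty (big _ _ _ ∷ E)   none = contradiction (here refl) none

  -- Makes the number of tiny items the only constraint on a slot without big items, even for large
  -- ones.
  diag≤card : ∀ {t} E → (∀ {b i k} → ¬ (big b i k ∈ E)) →
    (∀ {v i k} → small v i k ∈ E ⊎ large v i k ∈ E → val v ℚ.≤ val κ) → total (diag t) E ℚ.≤ total card E
  diag≤card []                none ≤κ = ℚ.≤-refl
  diag≤card (small _ _ _ ∷ E) none ≤κ = ℚ.+-mono-≤ (≤κ (inj₁ (here refl)))
    (diag≤card E (none ∘ there) λ { (inj₁ x) → ≤κ (inj₁ (there x)) ; (inj₂ x) → ≤κ (inj₂ (there x)) })
  diag≤card (large _ _ _ ∷ E) none ≤κ = ℚ.+-mono-≤ (≤κ (inj₂ (here refl)))
    (diag≤card E (none ∘ there) λ { (inj₁ x) → ≤κ (inj₁ (there x)) ; (inj₂ x) → ≤κ (inj₂ (there x)) })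
  diag≤card (big _ _ _ ∷ E)   none ≤κ = contradiction (here refl) none

  -- S is the sum of the sizes of the small items and H a lower bound for those of the
  -- large ones; n tiny items are still to come. The small items fill q slots and a
  -- fraction f / K of the next one, the large items e slots and a fraction F / K.
  record State (E : List Entry) (n : ℕ) : Set where
    field
      S H     : ℚ
      q f e F : ℕ
      played  : Played E
      bins-ok : ∀ k → BinOK (content bin E k)
      no-big  : ∀ {b i k} → ¬ (big b i k ∈ E)
      ≤κ      : ∀ {v i k} → small v i k ∈ E ⊎ large v i k ∈ E → val v ℚ.≤ val κ
      H≤large : ∀ {v i k} → large v i k ∈ E → H ℚ.≤ val v
      0≤S     : 0ℚ ℚ.≤ S
      0<H     : 0ℚ ℚ.< H
      H≤κ     : H ℚ.≤ val κ
      S<H     : S ℚ.< weight n ℚ.* H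
      diag≤S  : ∀ {j t} → j < M → total (diag t) (content slot E j) ℚ.≤ S
      ≤K      : ∀ j → occupancy E j ≤ K
      f<K     : f < K
      F<K     : F < K
      small-cursor : Cursor (_< M) E q f
      large-cursor : Cursor (M ≤_) E (M + e) F
      slots≤  : ∀ {x} → x ∈ E → slot x ≤ M + e
      #small  : q * K + f + sum larges E ≡ sum tinies E
      #large  : e * K + F ≡ sum larges E
      #tiny   : sum tinies E + n ≡ K * M

  start : State [] (K * M)
  start = record
    { S = 0ℚ ; H = val κ ; q = 0 ; f = 0 ; e = 0 ; F = 0
    ; played  = []
    ; bins-ok = λ _ → empty
    ; no-big  = λ ()
    ; ≤κ      = λ { (inj₁ ()) ; (inj₂ ()) }
    ; H≤large = λ ()
    ; 0≤S     = ℚ.≤-refl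
    ; 0<H     = 0<val κ
    ; H≤κ     = ℚ.≤-refl
    ; S<H     = 0<* (0<weight (K * M)) (0<val κ)
    ; diag≤S  = λ _ → ℚ.≤-refl
    ; ≤K      = λ _ → z≤n
    ; f<K     = ℕ.<-trans ℕ.0<1+n 1<K
    ; F<K     = ℕ.<-trans ℕ.0<1+n 1<K
    ; small-cursor = (λ _ → z≤n) , (λ _ _ _ → z≤n)
    ; large-cursor = (λ _ → z≤n) , (λ _ _ _ → z≤n)
    ; slots≤  = λ ()
    ; #small  = refl
    ; #large  = refl
    ; #tiny   = refl
    }

  module Step {E n} (St : State E (suc n)) where
    open State St hiding (S; H; q; f; e; F)
    open State St using () renaming (S to S₀; H to H₀; q to q₀; f to f₀; e to e₀; F to F₀)

    -- With `w = weight n` and `v = w H / 2`, the state gives `S < w v`. So `v` may become the new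
    -- `H` if the item is large; if it is small, `S + v < v + v = w H`.
    v₀ : ℚ
    v₀ = ½ ℚ.* weight n ℚ.* H₀

    0<v : 0ℚ ℚ.< v₀
    0<v = 0<* (0<* 0<½ (0<weight n)) 0<H

    v+v≡ : v₀ ℚ.+ v₀ ≡ weight n ℚ.* H₀
    v+v≡ = trans (sym (ℚ.*-distribʳ-+ H₀ (½ ℚ.* weight n) (½ ℚ.* weight n)))
      (cong (ℚ._* H₀) (½*p+½*p (weight n)))

    v≤H : v₀ ℚ.≤ H₀
    v≤H = *-≤1 (ℚ.<⇒≤ 0<H)
      (ℚ.≤-trans (*-≤1 (ℚ.<⇒≤ (0<weight n)) ½≤1) (weight≤1 n))

    v≤κ : v₀ ℚ.≤ val κ
    v≤κ = ℚ.≤-trans v≤H H≤κ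

    v : 𝕀
    v = ⟨ v₀ , 0<v , ℚ.≤-<-trans v≤κ (val<1 κ) ⟩

    S<wv : S₀ ℚ.< weight n ℚ.* v₀
    S<wv = subst (S₀ ℚ.<_) (ℚ.*-assoc (weight n) (½ ℚ.* weight n) H₀) S<H

    S+v<wH : S₀ ℚ.+ v₀ ℚ.< weight n ℚ.* H₀
    S+v<wH = subst (S₀ ℚ.+ v₀ ℚ.<_) v+v≡
      (ℚ.+-monoˡ-< v₀ (ℚ.<-≤-trans S<wv (*-≤1 (ℚ.<⇒≤ 0<v) (weight≤1 n))))

    k : ℕ
    k = strategy (input E) (toItem (tiny v))

    -- Fewer than `K * M` tiny items have come so far, so the slots of the small ones are not all
    -- full.
    q₀<M : q₀ < M
    q₀<M = ℕ.*-cancelˡ-< K q₀ M (begin-strict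
      K * q₀                      ≡⟨ ℕ.*-comm K q₀ ⟩
      q₀ * K                      ≤⟨ ℕ.m≤m+n (q₀ * K) f₀ ⟩
      q₀ * K + f₀                 ≤⟨ ℕ.m≤m+n (q₀ * K + f₀) (sum larges E) ⟩
      q₀ * K + f₀ + sum larges E  ≡⟨ #small ⟩
      sum tinies E                <⟨ ℕ.m<m+n (sum tinies E) ℕ.0<1+n ⟩
      sum tinies E + suc n        ≡⟨ #tiny ⟩
      K * M                       ∎)
      where open ℕ.≤-Reasoning

    bins-ok′ : ∀ x → bin x ≡ k → BinOK (x ∷ content bin E k) → ∀ k′ → BinOK (content bin (x ∷ E) k′)
    bins-ok′ x eq ok k′ = content-elim BinOK bin x E
      (λ hit → subst (λ k → BinOK (x ∷ content bin E k)) (trans (sym eq) hit) ok) (λ _ → bins-ok k′)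

    ≤K′ : ∀ x → tinies x ≡ 1 → occupancy E (slot x) < K → ∀ j → occupancy (x ∷ E) j ≤ K
    ≤K′ x t≡1 <K j = content-elim (λ C → sum tinies C ≤ K) slot x E
      (λ { refl → subst (λ m → m + occupancy E (slot x) ≤ K) (sym t≡1) <K }) (λ _ → ≤K j)

    small-next : TinyBin (content bin E k) → ∃[ x ] State (x ∷ E) n
    small-next tb = let q′ , f′ , f′<K , count , move = advance q₀ f₀ f<K in x , record
      { S = S₀ ℚ.+ v₀ ; H = H₀ ; q = q′ ; f = f′ ; e = e₀ ; F = F₀
      ; played  = refl ∷ played
      ; bins-ok = bins-ok′ x refl (tiny (more tb))
      ; no-big  = λ { (there x∈E) → no-big x∈E }
      ; ≤κ      = λ { (inj₁ (here refl)) → v≤κ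
                    ; (inj₁ (there x∈E)) → ≤κ (inj₁ x∈E)
                    ; (inj₂ (there x∈E)) → ≤κ (inj₂ x∈E) }
      ; H≤large = λ { (there x∈E) → H≤large x∈E }
      ; 0≤S     = ℚ.+-mono-≤ 0≤S (ℚ.<⇒≤ 0<v)
      ; 0<H     = 0<H
      ; H≤κ     = H≤κ
      ; S<H     = S+v<wH
      ; diag≤S  = λ {j} {t} j<M → content-elim (λ C → total (diag t) C ℚ.≤ S₀ ℚ.+ v₀) slot x E
                    (λ _ → subst (v₀ ℚ.+ total (diag t) (content slot E j) ℚ.≤_) (ℚ.+-comm v₀ S₀)
                      (ℚ.+-monoʳ-≤ v₀ (diag≤S j<M)))
                    (λ _ → subst (ℚ._≤ S₀ ℚ.+ v₀) (ℚ.+-identityʳ _) (ℚ.+-mono-≤ (diag≤S j<M) (ℚ.<⇒≤ 0<v)))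
      ; ≤K      = ≤K′ x refl (ℕ.≤-<-trans (proj₁ small-cursor q₀<M) f<K)
      ; f<K     = f′<K
      ; F<K     = F<K
      ; small-cursor = cursor-here x refl refl q₀<M small-cursor move
      ; large-cursor = cursor-elsewhere x (ℕ.<⇒≱ q₀<M) large-cursor
      ; slots≤  = λ { (here refl) → ℕ.≤-trans (ℕ.<⇒≤ q₀<M) (ℕ.m≤m+n M e₀) ; (there x∈E) → slots≤ x∈E }
      ; #small  = trans (cong (_+ sum larges E) count) (cong suc #small)
      ; #large  = #large
      ; #tiny   = trans (sym (ℕ.+-suc (sum tinies E) n)) #tiny
      }
      where
      x = small v q₀ k

    large-next : content bin E k ≡ [] → ∃[ x ] State (x ∷ E) n
    large-next new = let e′ , F′ , F′<K , count , move = advance e₀ F₀ F<K in x , record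
      { S = S₀ ; H = v₀ ; q = q₀ ; f = f₀ ; e = e′ ; F = F′
      ; played  = refl ∷ played
      ; bins-ok = bins-ok′ x refl (subst (BinOK ∘ (x ∷_)) (sym new) (tiny first))
      ; no-big  = λ { (there x∈E) → no-big x∈E }
      ; ≤κ      = λ { (inj₂ (here refl)) → v≤κ
                    ; (inj₁ (there x∈E)) → ≤κ (inj₁ x∈E)
                    ; (inj₂ (there x∈E)) → ≤κ (inj₂ x∈E) }
      ; H≤large = λ { (here refl) → ℚ.≤-refl ; (there x∈E) → ℚ.≤-trans v≤H (H≤large x∈E) }
      ; 0≤S     = 0≤S
      ; 0<H     = 0<v
      ; H≤κ     = v≤κ
      ; S<H     = S<wv
      ; diag≤S  = λ {j} {t} j<M → subst (λ C → total (diag t) C ℚ.≤ S₀)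
                    (sym (content-miss slot x E (ℕ.>⇒≢ (ℕ.<-≤-trans j<M (ℕ.m≤m+n M e₀))))) (diag≤S j<M)
      ; ≤K      = ≤K′ x refl (ℕ.≤-<-trans (proj₁ large-cursor (ℕ.m≤m+n M e₀)) F<K)
      ; f<K     = f<K
      ; F<K     = F′<K
      ; small-cursor = cursor-elsewhere x (ℕ.≤⇒≯ (ℕ.m≤m+n M e₀)) small-cursor
      ; large-cursor = cursor-here x refl refl (ℕ.m≤m+n M e₀) large-cursor (shift move)
      ; slots≤  = λ { (here refl) → ℕ.+-monoʳ-≤ M (e≤ move)
                    ; (there x∈E) → ℕ.≤-trans (slots≤ x∈E) (ℕ.+-monoʳ-≤ M (e≤ move)) }
      ; #small  = trans (ℕ.+-suc (q₀ * K + f₀) (sum larges E)) (cong suc #small)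
      ; #large  = trans count (cong suc #large)
      ; #tiny   = trans (sym (ℕ.+-suc (sum tinies E) n)) #tiny
      }
      where
      x = large v (M + e₀) k

      shift : ∀ {e′ F′} → (e′ ≡ e₀ × F′ ≡ suc F₀) ⊎ (e′ ≡ suc e₀) →
        (M + e′ ≡ M + e₀ × F′ ≡ suc F₀) ⊎ (M + e′ ≡ suc (M + e₀))
      shift (inj₁ (refl , eq)) = inj₁ (refl , eq)
      shift (inj₂ refl)        = inj₂ (ℕ.+-suc M e₀)

      e≤ : ∀ {e′ F′} → (e′ ≡ e₀ × F′ ≡ suc F₀) ⊎ (e′ ≡ suc e₀) → e₀ ≤ e′
      e≤ (inj₁ (refl , _)) = ℕ.≤-refl
      e≤ (inj₂ refl)       = ℕ.n≤1+n e₀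

    next : ∃[ x ] State (x ∷ E) n
    next = go refl (bins-ok k)
      where
      old : ∀ b i k′ → big b i k′ ∈ content bin E k → big b i k′ ∈ E
      old _ _ _ = proj₁ ∘ content-⊆ bin E

      go : ∀ {C} → content bin E k ≡ C → BinOK C → ∃[ x ] State (x ∷ E) n
      -- The size was fixed before the answer of the algorithm; only now is the item declared large
      -- or small.
      go new  empty     = large-next new
      go refl (tiny tb) = small-next tb
      go eq   (one {b} {i} {k′})           =
        contradiction (old b i k′ (subst (big b i k′ ∈_) (sym eq) (here refl))) no-big
      go eq   (two {b} {i = i} {k = k′} _) =
        contradiction (old b i k′ (subst (big b i k′ ∈_) (sym eq) (here refl))) no-big

  run : ∀ n {E} → State E n → ∃[ E′ ] State E′ 0
  run zero    {E} St = E , St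
  run (suc n)     St = run n (proj₂ (Step.next St))

  open State

  module Finish {E} (St : State E 0) (a : 𝕀) (a<½ : val a ℚ.< ½)
    (S≤a : S St ℚ.≤ val a) (a<H : val a ℚ.< H St) where

    -- Besides the first `M` slots there are `e` full ones of large items and one for the remainder.
    N : ℕ
    N = suc (M + e St)

    open Phases M N (ℕ.m≤n⇒m≤1+n (ℕ.m≤m+n M (e St))) a a<½ (K * M) (sum larges E)

    no-big-slot : ∀ j {b i k} → ¬ (big b i k ∈ content slot E j)
    no-big-slot j x∈ = no-big St (proj₁ (content-⊆ slot E x∈))

    slot-card : ∀ j → total card (content slot E j) ℚ.≤ 1ℚ
    slot-card j = subst₂ ℚ._≤_ (sym (total-card (content slot E j))) K·κ≡1 (multiple-mono (≤K St j))

    slots≤1 : ∀ j {δ} → Valid r δ → total δ (content slot E j) ℚ.≤ 1ℚ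
    slots≤1 j card       = slot-card j
    slots≤1 j (diag _)   = ℚ.≤-trans (diag≤card (content slot E j) (no-big-slot j)
      λ { (inj₁ x∈) → ≤κ St (inj₁ (proj₁ (content-⊆ slot E x∈)))
        ; (inj₂ x∈) → ≤κ St (inj₂ (proj₁ (content-⊆ slot E x∈))) }) (slot-card j)
    slots≤1 j (pair _ _) = subst (ℚ._≤ 1ℚ)
      (sym (pair-empty (content slot E j) (no-big-slot j))) (ℚ.<⇒≤ (ℚ.positive⁻¹ 1ℚ))

    invariant : Invariant E
    invariant = record
      { played   = played St
      ; bins-ok  = bins-ok St
      ; heavy    = λ x∈E → ℚ.<-≤-trans a<H (H≤large St x∈E)
      ; monotone = λ x∈E → contradiction x∈E (no-big St)
      ; slots≤1  = slots≤1
      ; diag≤a   = λ j<M _ → ℚ.≤-trans (diag≤S St j<M) S≤a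
      ; pair≤    = λ σ {j} p _ _ _ 0≤p _ →
          subst (ℚ._≤ p) (sym (pair-empty (content slot E j) (no-big-slot j))) 0≤p
      ; slots<N  = λ x∈E → s≤s (slots≤ St x∈E)
      ; tinies≡  = trans (sym (ℕ.+-identityʳ _)) (#tiny St)
      ; larges≡  = refl
      }

open import Data.Integer as ℤ using (+_; -[1+_])
import Data.Integer.Properties as ℤ
import Data.Integer.Tactic.RingSolver as ℤ
open import Data.Rational.Unnormalised as ℚᵘ using (mkℚᵘ; *<*; *≡*)
import Data.Rational.Unnormalised.Properties as ℚᵘ

-- The outcome

module _ {d} (A : OnlineAlgorithm d) where
  open OnlineAlgorithm A

  used-≤ : ∀ L x → used strategy L ≤ used strategy (x ∷ L)
  used-≤ L x with strategy L x ≟ used strategy L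
  ... | yes p = subst (λ t → used strategy L ≤ (if t then suc (used strategy L) else used strategy L))
    (sym (dec-true (strategy L x ≟ used strategy L) p)) (ℕ.n≤1+n _)
  ... | no ¬p = subst (λ t → used strategy L ≤ (if t then suc (used strategy L) else used strategy L))
    (sym (dec-false (strategy L x ≟ used strategy L) ¬p)) ℕ.≤-refl

  strategy<used : ∀ L x → strategy L x < used strategy (x ∷ L)
  strategy<used L x with strategy L x ≟ used strategy L
  ... | yes p = subst (λ t → strategy L x < (if t then suc (used strategy L) else used strategy L))
    (sym (dec-true (strategy L x ≟ used strategy L) p)) (s≤s (ℕ.≤-reflexive p))
  ... | no ¬p = ℕ.<-≤-trans (ℕ.≤∧≢⇒< (usedOrNew L x) ¬p) (used-≤ L x)

  assigned<used : ∀ L i → assigned strategy L i < used strategy L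
  assigned<used (x ∷ L) zero    = strategy<used L x
  assigned<used (x ∷ L) (suc i) = ℕ.<-≤-trans (assigned<used L i) (used-≤ L x)

toℚᵘ-/ : ∀ i n → toℚᵘ (i / suc n) ℚᵘ.≃ mkℚᵘ i n
toℚᵘ-/ i n = ℚ.toℚᵘ-fromℚᵘ (mkℚᵘ i n)

</⁻ : ∀ {p i n} → p ℚ.< i / suc n → ↥ p ℤ.* + suc n ℤ.< i ℤ.* ↧ p
</⁻ {p@record{}} {i} {n} lt = ℚᵘ.drop-*<* (ℚᵘ.<-respʳ-≃ (toℚᵘ-/ i n) (ℚ.toℚᵘ-mono-< lt))

</⁺ : ∀ {p i n} → ↥ p ℤ.* + suc n ℤ.< i ℤ.* ↧ p → p ℚ.< i / suc n
</⁺ {p@record{}} {i} {n} lt = ℚ.toℚᵘ-cancel-< (ℚᵘ.<-respʳ-≃ (ℚᵘ.≃-sym (toℚᵘ-/ i n)) (*<* lt))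

suc-/ : ∀ m n → + 1 / suc n ℚ.+ + m / suc n ≡ + suc m / suc n
suc-/ m n = ℚ.toℚᵘ-injective (begin
  toℚᵘ (+ 1 / suc n ℚ.+ + m / suc n)          ≈⟨ ℚ.toℚᵘ-homo-+ (+ 1 / suc n) (+ m / suc n) ⟩
  toℚᵘ (+ 1 / suc n) ℚᵘ.+ toℚᵘ (+ m / suc n)  ≈⟨ ℚᵘ.+-cong (toℚᵘ-/ (+ 1) n) (toℚᵘ-/ (+ m) n) ⟩
  mkℚᵘ (+ 1) n ℚᵘ.+ mkℚᵘ (+ m) n              ≈⟨ *≡* (identity (+ m) (+ suc n)) ⟩
  mkℚᵘ (+ suc m) n                            ≈⟨ toℚᵘ-/ (+ suc m) n ⟨
  toℚᵘ (+ suc m / suc n)                      ∎)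
  where
  open import Relation.Binary.Reasoning.Setoid ℚᵘ.≃-setoid
  identity : ∀ m k → (+ 1 ℤ.* k ℤ.+ m ℤ.* k) ℤ.* k ≡ (+ 1 ℤ.+ m) ℤ.* (k ℤ.* k)
  identity = ℤ.solve-∀

n/n≡1 : ∀ n → + suc n / suc n ≡ 1ℚ
n/n≡1 n = ℚ.toℚᵘ-injective (ℚᵘ.≃-trans (toℚᵘ-/ (+ suc n) n) (*≡* (ℤ.*-comm (+ suc n) (+ 1))))

1/n≤½ : ∀ n → + 1 / suc (suc n) ℚ.≤ ½
1/n≤½ n = ℚ.≮⇒≥ λ lt → ℤ.<⇒≱ (</⁻ {½} {+ 1} {suc n} lt) (ℤ.+≤+ (s≤s (s≤s z≤n)))

-- The denominators start at 2 to ensure `κ ≤ ½`, from which `a < ½` will follow.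
reciprocal : ℕ → 𝕀
reciprocal n = ⟨ + 1 / suc (suc n) , </⁺ {0ℚ} {+ 1} {suc n} (ℤ.+<+ (s≤s z≤n)) ,
  ℚ.≤-<-trans (1/n≤½ n) (ℚ.*<* (ℤ.+<+ (s≤s (s≤s z≤n)))) ⟩

n<2^n : ∀ n → n < 2 ^ n
n<2^n zero    = s≤s z≤n
n<2^n (suc n) = ℕ.≤-trans (ℕ.+-mono-≤ (ℕ.≤-trans (s≤s z≤n) (n<2^n n)) (n<2^n n))
  (ℕ.≤-reflexive (cong (λ x → 2 ^ n + x) (sym (ℕ.+-identityʳ (2 ^ n)))))

module Outcome
  (r d : ℕ) (r²≤d : r * r ≤ d) (A : OnlineAlgorithm (suc d)) (c D k : ℕ) where

  K : ℕ
  K = suc (suc k)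

  κ : 𝕀
  κ = reciprocal k

  open Adversary r d r²≤d κ A c D

  M : ℕ
  M = level 0

  multiple≡ : ∀ n → multiple n ≡ + n / K
  multiple≡ zero    = sym (ℚ.0/n≡0 K)
  multiple≡ (suc n) = trans (cong (val κ ℚ.+_) (multiple≡ n)) (suc-/ n (suc k))

  K·κ≡1 : multiple K ≡ 1ℚ
  K·κ≡1 = trans (multiple≡ K) (n/n≡1 (suc k))

  module T = TinyStage r d r²≤d κ A Cut Cut-mono M K (s≤s (s≤s z≤n)) K·κ≡1

  E₀ : List Entry
  E₀ = proj₁ (T.run (K * M) T.start)

  St : T.State E₀ 0
  St = proj₂ (T.run (K * M) T.start)

  open T.State St using (S; H; e; F; 0≤S; H≤κ; no-big; #large) renaming (S<H to S<1*H)

  S<H : S ℚ.< H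
  S<H = subst (S ℚ.<_) (ℚ.*-identityˡ H) S<1*H

  a₀ : ℚ
  a₀ = proj₁ (ℚ.<-dense S<H)

  S<a : S ℚ.< a₀
  S<a = proj₁ (proj₂ (ℚ.<-dense S<H))

  a<H : a₀ ℚ.< H
  a<H = proj₂ (proj₂ (ℚ.<-dense S<H))

  a<½ : a₀ ℚ.< ½
  a<½ = ℚ.<-≤-trans a<H (ℚ.≤-trans H≤κ (1/n≤½ k))

  a : 𝕀
  a = ⟨ a₀ , ℚ.≤-<-trans 0≤S S<a , ℚ.<-≤-trans a<½ ½≤1 ⟩

  open T.Finish St a a<½ (ℚ.<⇒≤ S<a) a<H using (N; invariant)
  open Run N (ℕ.m≤n⇒m≤1+n (ℕ.m≤m+n M e)) a a<½ (K * M) (sum larges E₀)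

  final : ∃[ E ] Invariant E × Before r E × r * (g * M) ≤ g * sum bigs E + r * M
  final = phases invariant (λ x∈E → contradiction x∈E no-big) r ℕ.≤-refl

  E : List Entry
  E = proj₁ final

  open Invariant (proj₁ (proj₂ final)) hiding (slots≤1)

  label< : ∀ f E {n} → (∀ {x} → x ∈ E → f x < n) → ∀ i → label f E i < n
  label< f (x ∷ E) f<n zero    = f<n (here refl)
  label< f (x ∷ E) f<n (suc i) = label< f E (f<n ∘ there) i

  offline : Fits (input E) N
  offline = fits (label slot E) (label< slot E slots<N)
    (total≤1⇒feasible E (label slot E) (Invariant.slots≤1 (proj₁ (proj₂ final))))

  -- No bin of any packing holds more than `K` of the `K * M` tiny items. This is the lower bound on
  -- the optimum.
  M≤bins : ∀ {m} → Fits (input E) m → M ≤ m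
  M≤bins {m} (fits b b<m feasible) = ℕ.*-cancelˡ-≤ K (begin
    K * M         ≡⟨ tinies≡ ⟨
    sum tinies E  ≤⟨ sum-≤-* tinies E b m b<m tinies≤K ⟩
    m * K         ≡⟨ ℕ.*-comm m K ⟩
    K * m         ∎)
    where
    open ℕ.≤-Reasoning
    tinies≤K : ∀ j → sum tinies (contentOf E b j) ≤ K
    tinies≤K j = multiple-cancel (subst₂ ℚ._≤_ (total-card (contentOf E b j)) (sym K·κ≡1)
      (feasible⇒total≤1 E b feasible j card))

  #bins : ℕ
  #bins = bins A (input E)

  bin< : ∀ i → label bin E i < #bins
  bin< i = subst (_< #bins) (played-assigned played i) (assigned<used A (input E) i)

  tinyBin-larges : ∀ {C} → TinyBin C → sum larges C ≡ 1
  tinyBin-larges first     = refl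
  tinyBin-larges (more tb) = tinyBin-larges tb

  tinyBin-bigs : ∀ {C} → TinyBin C → sum bigs C ≡ 0
  tinyBin-bigs first     = refl
  tinyBin-bigs (more tb) = tinyBin-bigs tb

  #larges : ℕ
  #larges = sum larges E₀

  -- Each bin of the algorithm with tiny items has at most `K` of them and exactly one is large.
  M≤larges : M ≤ #larges
  M≤larges = ℕ.*-cancelˡ-≤ K (begin
    K * M                        ≡⟨ tinies≡ ⟨
    sum tinies E                 ≤⟨ sum-mono tinies (λ x → K * larges x) E (label bin E) #bins bin<
                                      (λ j → ratio (bins-ok j) (tinies≤K j)) ⟩
    sum (λ x → K * larges x) E   ≡⟨ sum-* K larges E ⟩
    K * sum larges E             ≡⟨ cong (K *_) larges≡ ⟩
    K * #larges                  ∎)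
    where
    open ℕ.≤-Reasoning
    tinies≤K : ∀ j → sum tinies (content bin E j) ≤ K
    tinies≤K j = multiple-cancel (subst₂ ℚ._≤_ (total-card (content bin E j)) (sym K·κ≡1)
      (played⇒total≤1 played j card))

    ratio : ∀ {C} → BinOK C → sum tinies C ≤ K → sum tinies C ≤ sum (λ x → K * larges x) C
    ratio empty     _  = z≤n
    ratio one       _  = z≤n
    ratio (two _)   _  = z≤n
    ratio {C} (tiny tb) ≤K = ℕ.≤-trans ≤K (ℕ.≤-reflexive
      (sym (trans (sum-* K larges C) (trans (cong (K *_) (tinyBin-larges tb)) (ℕ.*-identityʳ K)))))

  -- With weight 2 for large and 1 for big items, a bin has total weight at most 2.
  2*bins : 2 * #larges + sum bigs E ≤ 2 * #bins
  2*bins = begin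
    2 * #larges + sum bigs E               ≡⟨ cong (λ l → 2 * l + sum bigs E) larges≡ ⟨
    2 * sum larges E + sum bigs E          ≡⟨ cong (_+ sum bigs E) (sum-* 2 larges E) ⟨
    sum (λ x → 2 * larges x) E + sum bigs E ≡⟨ sum-+ (λ x → 2 * larges x) bigs E ⟨
    sum w E                                ≤⟨ sum-≤-* w E (label bin E) #bins bin< (λ j → two-each (bins-ok j)) ⟩
    #bins * 2                              ≡⟨ ℕ.*-comm #bins 2 ⟩
    2 * #bins                              ∎
    where
    open ℕ.≤-Reasoning
    w : Entry → ℕ
    w x = 2 * larges x + bigs x

    two-each : ∀ {C} → BinOK C → sum w C ≤ 2
    two-each empty         = z≤n
    two-each one           = s≤s z≤n
    two-each (two _)       = ℕ.≤-refl
    two-each {C} (tiny tb) = ℕ.≤-reflexive (trans (sum-+ (λ x → 2 * larges x) bigs C)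
      (cong₂ _+_ (trans (sum-* 2 larges C) (cong (2 *_) (tinyBin-larges tb))) (tinyBin-bigs tb)))

  eK≤larges : e * K ≤ #larges
  eK≤larges = ℕ.≤-trans (ℕ.m≤m+n (e * K) F) (ℕ.≤-reflexive #large)

-- Only numbers survive: `l` counts the large items, `b` the big ones and `e` the full slots of
-- large items, which are few compared to `l` when `k` is large.
outcome : ∀ {r d} → r * r ≤ d → (A : OnlineAlgorithm (suc d)) → ∀ c D k →
  let g = 2 ^ D ; M = c * g ^ r in
  ∃[ L ] ∃[ m ] ∃[ e ] ∃[ l ] ∃[ b ] IsOPT L m × M ≤ m × m ≤ suc (M + e) ×
    e * (2 + k) ≤ l × M ≤ l × 2 * l + b ≤ 2 * bins A L × r * (g * M) ≤ g * b + r * M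
outcome {r} {d} r²≤d A c D k =
  let m , opt , F , m≤N = fits⇒OPT (input E) offline in
  input E , m , e , #larges , sum bigs E , opt , M≤bins F , m≤N , eK≤larges , M≤larges , 2*bins ,
  proj₂ (proj₂ (proj₂ final))
  where
  open Outcome r d r²≤d A c D k
  open Vectors r d r²≤d κ using (input; sum; bigs)
  open T.State St using (e)

-- The ratio

-- The fraction `x / y` is to be beaten; that it is less than `(r + 2) / 2` becomes `2 * x < Y`. The
-- sizes of `g`, `M` and of the factor of `e` control the three sources of error.
module Estimate {r x y g M m e l b A : ℕ}
  (0<y : 0 < y) (2x<Y : 2 * x < (r + 2) * y)
  (4Y≤g : 4 * ((r + 2) * y) ≤ g) (2Y<M : 2 * ((r + 2) * y) < M)
  (m≤ : m ≤ suc (M + e)) (eK≤l : e * (4 * ((r + 2) * y)) ≤ l) (M≤l : M ≤ l)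
  (2A≥ : 2 * l + b ≤ 2 * A) (phases≥ : r * (g * M) ≤ g * b + r * M)
  where

  open ℕ.≤-Reasoning

  Y : ℕ
  Y = (r + 2) * y

  0<g : 0 < g
  0<g = ℕ.<-≤-trans (ℕ.≤-<-trans z≤n 2x<Y) (ℕ.≤-trans (ℕ.m≤m+n Y _) 4Y≤g)

  -- The slots missed in the phases number at most `r M / g`; times `4 * y` this is at most `M` by
  -- the choice of `g`.
  bigs≥ : 4 * y * r * M ≤ 4 * y * b + M
  bigs≥ = ℕ.*-cancelˡ-≤ g {{>-nonZero 0<g}} (begin
    g * (4 * y * r * M)             ≡⟨ identity₁ g y r M ⟩
    4 * y * (r * (g * M))           ≤⟨ ℕ.*-monoʳ-≤ (4 * y) phases≥ ⟩
    4 * y * (g * b + r * M)         ≡⟨ identity₂ g y r b M ⟩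
    g * (4 * y * b) + 4 * (r * y) * M ≤⟨ ℕ.+-monoʳ-≤ (g * (4 * y * b)) (ℕ.*-monoˡ-≤ M (ℕ.≤-trans
                                       (ℕ.*-monoʳ-≤ 4 (ℕ.*-monoˡ-≤ y (ℕ.m≤m+n r 2))) 4Y≤g)) ⟩
    g * (4 * y * b) + g * M         ≡⟨ ℕ.*-distribˡ-+ g (4 * y * b) M ⟨
    g * (4 * y * b + M)             ∎)
    where
    identity₁ : ∀ g y r M → g * (4 * y * r * M) ≡ 4 * y * (r * (g * M))
    identity₁ = solve-∀
    identity₂ : ∀ g y r b M → 4 * y * (g * b + r * M) ≡ g * (4 * y * b) + 4 * (r * y) * M
    identity₂ = solve-∀

  -- After scaling by 8, the gap of at least 1 between `2 * x` and `Y` is worth at least `4 * M`. Of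
  -- this, `M` pays for the missed slots, `M` for part of the slots of large items, and `2 * M`,
  -- which exceeds `4 * Y`, for the one extra slot.
  ratio> : x * m < y * A
  ratio> = ℕ.*-cancelˡ-< 8 (x * m) (y * A) (ℕ.+-cancelʳ-< (4 * M) (8 * (x * m)) (8 * (y * A)) (begin-strict
    8 * (x * m) + 4 * M                     ≤⟨ ℕ.+-mono-≤ (ℕ.*-monoʳ-≤ 8 (ℕ.*-monoʳ-≤ x m≤)) (ℕ.*-monoʳ-≤ 4 M≤n) ⟩
    8 * (x * n) + 4 * n                     ≡⟨ identity₁ x n ⟩
    4 * (suc (2 * x) * n)                   ≤⟨ ℕ.*-monoʳ-≤ 4 (ℕ.*-monoˡ-≤ n 2x<Y) ⟩
    4 * (Y * n)                             ≡⟨ identity₂ r y M e ⟩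
    4 * y * r * M + 8 * y * M + e * (4 * Y) + 4 * Y  ≤⟨ ℕ.+-monoˡ-≤ (4 * Y)
                                                 (ℕ.+-monoʳ-≤ (4 * y * r * M + 8 * y * M) eK≤l) ⟩
    4 * y * r * M + 8 * y * M + l + 4 * Y   ≡⟨ ℕ.+-assoc (4 * y * r * M + 8 * y * M) l (4 * Y) ⟩
    -- Of the cost `l` of the slots of large items, `M` is charged to the gap; the excess `w` is
    -- paid for by the bins that these further large items open.
    4 * y * r * M + 8 * y * M + (l + 4 * Y) ≡⟨ cong (λ z → 4 * y * r * M + 8 * y * M + (z + 4 * Y)) l≡ ⟨
    4 * y * r * M + 8 * y * M + (M + w + 4 * Y)     ≡⟨ identity₃ (4 * y * r * M) (8 * y) M w (4 * Y) ⟩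
    4 * y * r * M + (8 * y * M + 1 * w) + (M + 4 * Y) ≤⟨ ℕ.+-monoˡ-≤ (M + 4 * Y) (ℕ.+-monoʳ-≤ (4 * y * r * M)
                                                         (ℕ.+-monoʳ-≤ (8 * y * M) (ℕ.*-monoˡ-≤ w 1≤8y))) ⟩
    4 * y * r * M + (8 * y * M + 8 * y * w) + (M + 4 * Y) ≡⟨ cong (λ z → 4 * y * r * M + z + (M + 4 * Y))
                                                (trans (sym (ℕ.*-distribˡ-+ (8 * y) M w)) (cong (8 * y *_) l≡)) ⟩
    4 * y * r * M + 8 * y * l + (M + 4 * Y) ≤⟨ ℕ.+-monoˡ-≤ (M + 4 * Y) (ℕ.+-monoˡ-≤ (8 * y * l) bigs≥) ⟩
    4 * y * b + M + 8 * y * l + (M + 4 * Y) ≡⟨ identity₄ y l b M (4 * Y) ⟩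
    4 * y * (2 * l + b) + (2 * M + 4 * Y)   ≤⟨ ℕ.+-monoˡ-≤ (2 * M + 4 * Y) (ℕ.*-monoʳ-≤ (4 * y) 2A≥) ⟩
    4 * y * (2 * A) + (2 * M + 4 * Y)       <⟨ ℕ.+-monoʳ-< (4 * y * (2 * A)) (ℕ.+-monoʳ-< (2 * M) 4Y<2M) ⟩
    4 * y * (2 * A) + (2 * M + 2 * M)       ≡⟨ identity₅ y A M ⟩
    8 * (y * A) + 4 * M                     ∎))
    where
    n = suc (M + e)
    w = l ∸ M

    l≡ : M + w ≡ l
    l≡ = ℕ.m+[n∸m]≡n M≤l

    M≤n : M ≤ n
    M≤n = ℕ.m≤n⇒m≤1+n (ℕ.m≤m+n M e)

    1≤8y : 1 ≤ 8 * y
    1≤8y = ℕ.≤-trans 0<y (ℕ.m≤m+n y (7 * y))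

    4Y<2M : 4 * Y < 2 * M
    4Y<2M = subst (_< 2 * M) (sym (ℕ.*-assoc 2 2 Y)) (ℕ.*-monoʳ-< 2 2Y<M)

    identity₁ : ∀ x n → 8 * (x * n) + 4 * n ≡ 4 * (suc (2 * x) * n)
    identity₁ = solve-∀
    identity₂ : ∀ r y M e → 4 * ((r + 2) * y * suc (M + e)) ≡
      4 * y * r * M + 8 * y * M + e * (4 * ((r + 2) * y)) + 4 * ((r + 2) * y)
    identity₂ = solve-∀
    identity₃ : ∀ p q M w z → p + q * M + (M + w + z) ≡ p + (q * M + 1 * w) + (M + z)
    identity₃ = solve-∀
    identity₄ : ∀ y l b M z → 4 * y * b + M + 8 * y * l + (M + z) ≡ 4 * y * (2 * l + b) + (2 * M + z)
    identity₄ = solve-∀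
    identity₅ : ∀ y A M → 4 * y * (2 * A) + (2 * M + 2 * M) ≡ 8 * (y * A) + 4 * M
    identity₅ = solve-∀

numerator-bound : ∀ {p n} → 0 < n → p ℚ.< + n / 2 → ∃[ x ] ↥ p ℤ.≤ + x × 2 * x < n * ↧ₙ p
numerator-bound {ℚ.mkℚ (+ x) d _}    {n} 0<n lt = x , ℤ.≤-refl ,
  subst (_< n * suc d) (ℕ.*-comm x 2) (ℤ.drop‿+<+
    (subst₂ ℤ._<_ (sym (ℤ.pos-* x 2)) (sym (ℤ.pos-* n (suc d))) (</⁻ {i = + n} lt)))
-- A negative numerator is replaced by 0, so that natural numbers suffice for the estimate.
numerator-bound {ℚ.mkℚ -[1+ x ] d _} {n} 0<n lt = 0 , ℤ.-≤+ , ℕ.*-mono-≤ 0<n (s≤s z≤n)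

ratio-above : ∀ {d} (A : OnlineAlgorithm d) {p L m K} → IsOPT L m → K ≤ m → 0 < m →
  ↥ p ℤ.* + m ℤ.< + bins A L ℤ.* ↧ p → ∃[ s ] ratiosFrom A K s × p ℚ.< s
ratio-above A {L = L} {suc m} opt K≤m _ lt =
  + bins A L / suc m , (L , suc m , opt , K≤m , _ , refl) , </⁺ {i = + bins A L} lt

below-ratio : ∀ {r d} → r * r ≤ d → (A : OnlineAlgorithm (suc d)) → ∀ p → p ℚ.< + (r + 2) / 2 →
  ∀ K → ∃[ s ] ratiosFrom A K s × p ℚ.< s
below-ratio {r} {d} r²≤d A p p< K =
  let x , p≤x , 2x<Y = numerator-bound {p} {r + 2} (ℕ.<-≤-trans (s≤s z≤n) (ℕ.m≤n+m 2 r)) p<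
      L , m , e , l , b , opt , M≤m , m≤ , eK≤l , M≤l , 2A≥ , phases≥ = outcome {r} r²≤d A c D D
      x*m<y*A = Estimate.ratio> {r} {x} {y} {g} {M} {m} {e} {l} {b} {bins A L} (s≤s z≤n) 2x<Y (ℕ.<⇒≤ (n<2^n D))
        (ℕ.<-≤-trans (s≤s (ℕ.m≤n+m (2 * Y) K)) c≤M) m≤
        (ℕ.≤-trans (ℕ.*-monoʳ-≤ e (ℕ.m≤n+m D 2)) eK≤l) M≤l 2A≥ phases≥
      c≤m = ℕ.≤-trans c≤M M≤m
  in ratio-above A {p} opt (ℕ.≤-trans (ℕ.m≤n⇒m≤1+n (ℕ.m≤m+n K (2 * Y))) c≤m) (ℕ.<-≤-trans (s≤s z≤n) c≤m)
       (begin-strict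
         ↥ p ℤ.* + m        ≤⟨ ℤ.*-monoʳ-≤-nonNeg (+ m) p≤x ⟩
         + x ℤ.* + m        ≡⟨ ℤ.pos-* x m ⟨
         + (x * m)          <⟨ ℤ.+<+ x*m<y*A ⟩
         + (y * bins A L)   ≡⟨ cong +_ (ℕ.*-comm y (bins A L)) ⟩
         + (bins A L * y)   ≡⟨ ℤ.pos-* (bins A L) y ⟩
         + bins A L ℤ.* + y ∎)
  where
  open ℤ.≤-Reasoning
  y = ↧ₙ p
  Y = (r + 2) * y
  -- Used both as number of bisections, giving `g > 4 * Y`, and as the `k` of `outcome`, giving at
  -- least `4 * Y` tiny items per full slot.
  D = 4 * Y
  g = 2 ^ D
  -- Large enough for both `2 * Y < M` and an optimum of at least `K`.
  c = suc (K + 2 * Y)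
  M = c * g ^ r

  c≤M : c ≤ M
  c≤M = ℕ.m≤m*n c (g ^ r) {{ℕ.m^n≢0 g r {{ℕ.m^n≢0 2 D}}}}

mainTheorem3 : ∀ (d : ℕ) → 2 ≤ d → (A : OnlineAlgorithm d) →
    fromℚ (+ (⌊√ d ∸ 1 ⌋ + 2) / 2) ≤ᴱ asymptoticRatio A
mainTheorem3 (suc d) _ A q q< =
  -- The limit inferior asks for a rational above `q` that stays below the suprema; as it does so
  -- for every `K`, the threshold is 0.
  let p , q<p , p< = ℚ.<-dense q< in
  p , q<p , 0 , λ K _ → below-ratio {⌊√ d ⌋} (proj₁ (⌊√⌋-spec d)) A p p< K
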